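{- For a prime $p$, let $I(p)$ denote the number of solutions of the congruence $$x^x\equiv y^y\pmod p,\qquad x\in\mathbb{N},\quad y\in\mathbb{N},\quad x\le p-1,\quad y\le p-1.$$ Then, as $p\to\infty$, $I(p)\lesssim p^{23/12}$; that is, for every $\varepsilon>0$ there exists a constant $c=c(\varepsilon)>0$ such that for every prime $p$ one has $I(p)<c\,p^{23/12+\varepsilon}$.
   Context: $\mathbb{N}$ denotes the set of positive integers. The notation $A\lesssim B$ means $A<Bp^{o(1)}$; that is, for any $\varepsilon>0$ there exists $c=c(\varepsilon)>0$ such that $A<cBp^{\varepsilon}$. -}

module Defs where

open import Algebra.Definitions.RawSemiring using () renaming (_^_ to pow)
open import Data.Integer.Base using (+_; -[1+_])
open import Data.List.Base using (List; map; upTo; filter; length; cartesianProduct)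
open import Data.Nat.Base as ℕ using (ℕ; suc; _∸_; ∣_-_∣)
open import Data.Nat.Divisibility using (_∣_; _∣?_)
open import Data.Product.Base using (_×_; _,_)
open import Data.Rational.Unnormalised.Base as ℚ using (ℚᵘ; ↥_; ↧ₙ_; +-*-rawSemiring)
open import Relation.Nullary.Decidable.Core using (Dec)

infix 4 _≡_[mod_]

_≡_[mod_] : ℕ → ℕ → ℕ → Set
a ≡ b [mod m ] = m ∣ ∣ a - b ∣

Solution : ℕ → ℕ × ℕ → Set
Solution p (x , y) = x ℕ.^ x ≡ y ℕ.^ y [mod p ]

solution? : ∀ p xy → Dec (Solution p xy)
solution? p (x , y) = p ∣? ∣ x ℕ.^ x - y ℕ.^ y ∣

-- 1 , 2 , … , n
range : ℕ → List ℕ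
range n = map suc (upTo n)

I : ℕ → ℕ
I p = length (filter (solution? p) (cartesianProduct (range (p ∸ 1)) (range (p ∸ 1))))

infixr 8 _^ℚ_

_^ℚ_ : ℚᵘ → ℕ → ℚᵘ
_^ℚ_ = pow +-*-rawSemiring

fromℕ : ℕ → ℚᵘ
fromℕ n = + n ℚ./ 1

infix 4 _<_·_^_

-- The real inequality  a < c · pʳ  for a rational exponent r = m / n.  The real
-- number pʳ is the positive n-th root of pᵐ, so for c > 0 and p ≥ 1 the
-- inequality holds exactly when  aⁿ < cⁿ · pᵐ  (n ≥ 1, both sides nonnegative);
-- when m < 0 the factor pᵐ is moved to the left.  It is only meant for c > 0.
_<_·_^_ : ℕ → ℚᵘ → ℕ → ℚᵘ → Set
a < c · p ^ r with ↥ r | ↧ₙ r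
... | + m      | n = fromℕ a ^ℚ n ℚ.< c ^ℚ n ℚ.* fromℕ p ^ℚ m
... | -[1+ m ] | n = fromℕ a ^ℚ n ℚ.* fromℕ p ^ℚ suc m ℚ.< c ^ℚ n

{-# OPTIONS --safe #-}

-- For each divisor d of n = p − 1 consider A = {x : gcd (x , n) = d , xˣ ≡ λ (mod p)}.
-- If x , y ∈ A and ax ≡ by (mod n), then (xᵇ)ˣ ≡ (yᵃ)ˣ, hence x^(bd) ≡ y^(ad) by Bézout
-- and Fermat.  Writing ax = by + kn, we get by ≡ ax + k, so that x is a root modulo p of
-- b^(ad) X^(bd) − (aX + k)^(ad), a nontrivial equation of degree at most Rd when a , b ≤ R
-- and (a , x) ≠ (b , y).  Thus few pairs of products ax with a ≤ R collide modulo n, whereas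
-- by Cauchy–Schwarz at least (R |A|)² / (n / d) do, all these products being multiples of d.
-- With R ≈ p^(1/4) this yields |A|⁴ ≤ 256 p³.  Summing over d with τ(n) ≪ n^(1/6) bounds the
-- number of y with y^y ≡ xˣ by O(p^(11/12)) for every x, so I(p) = O(p^(23/12)).

module Submission where

open import Algebra.Properties.CommutativeSemigroup as CommutativeSemigroup using ()
import Algebra.Properties.AbelianGroup
open import Data.Integer.Base as ℤ using (ℤ; +_; 0ℤ; 1ℤ; -1ℤ; ∣_∣)
import Data.Integer.Divisibility.Signed as ℤ∣
import Data.Integer.Properties as ℤ
import Data.Integer.Tactic.RingSolver as ℤ
open import Data.List.Base using (List; []; _∷_; _++_; map; filter; length; cartesianProduct; upTo)
open import Data.List.Membership.Propositional using (_∈_)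
open import Data.List.Membership.Propositional.Properties
open import Data.List.Properties using (length-map; length-++; length-upTo; filter-++; ++-identityʳ)
open import Data.List.Relation.Binary.Permutation.Propositional using (_↭_; ↭-refl; ↭-trans; ↭-reflexive)
open import Data.List.Relation.Binary.Permutation.Propositional.Properties using (↭-length; ∈-resp-↭; shift; ++⁺ˡ)
open import Data.List.Relation.Unary.All as All using (All; []; _∷_)
import Data.List.Relation.Unary.All.Properties as All
open import Data.List.Relation.Unary.AllPairs using (AllPairs; []; _∷_)
open import Data.List.Relation.Unary.Any using (here; there)
open import Data.List.Relation.Unary.Unique.Propositional using (Unique)
import Data.List.Relation.Unary.Unique.Propositional.Properties as Unique
open import Data.Nat.Base as ℕ using (ℕ; zero; suc; _+_; _*_; _^_; _/_; _%_; _∸_; _⊔_; _≤_; _<_; z≤n; s≤s; NonZero; NonTrivial; >-nonZero; >-nonZero⁻¹; ≢-nonZero; ≢-nonZero⁻¹; nonTrivial⇒nonZero; nonTrivial⇒n>1)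
open import Data.Nat.Coprimality using (Coprime; coprime-divisor)
open import Data.Nat.DivMod using (m≡m%n+[m/n]*n; m%n<n; m/n*n≡m; m/n*n≤m; m/n≤m; m*n/n≡m; /-monoˡ-≤; m<n*o⇒m/o<n)
open import Data.Nat.Divisibility
open import Data.Nat.GCD using (gcd; gcd-GCD; gcd[m,n]∣m; gcd[m,n]∣n; module Bézout)
open import Data.Nat.Induction using (<-wellFounded)
open import Data.Nat.ListAction using (sum; product)
open import Data.Nat.ListAction.Properties using (product-↭; ∈⇒∣product)
open import Data.Nat.Primality
open import Data.Nat.Primality.Factorisation using (factorise; module PrimeFactorisation)
open import Data.Nat.Properties
open import Data.Nat.Solver using (module +-*-Solver)
open import Data.Nat.Tactic.RingSolver using (solve-∀)
open import Data.Product.Base using (_×_; _,_; proj₁; proj₂; ∃-syntax)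
open import Data.Product.Properties using (≡-dec)
open import Data.Rational.Unnormalised.Base as ℚ using (ℚᵘ; 0ℚᵘ; mkℚᵘ; ↥_; ↧ₙ_)
open import Data.Sum.Base using (_⊎_; inj₁; inj₂)
open import Defs
open import Function.Base using (_∘_; id)
open import Induction.WellFounded using (Acc; acc)
open import Relation.Binary.Bundles using (Setoid)
open import Relation.Binary.Definitions using (Tri; tri<; tri≈; tri>)
open import Relation.Binary.PropositionalEquality hiding ([_])
import Relation.Binary.Reasoning.Setoid
open import Relation.Nullary using (¬_; Dec; yes; no; contradiction; ¬?; _×-dec_)
open import Relation.Unary using (Decidable)

open CommutativeSemigroup +-commutativeSemigroup using () renaming (x∙yz≈y∙xz to x+[y+z]≡y+[x+z])
open CommutativeSemigroup *-commutativeSemigroup using (interchange; x∙yz≈y∙xz)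
module ℤ-Group = Algebra.Properties.AbelianGroup ℤ.+-0-abelianGroup
open +-*-Solver using (solve; _:=_; _:+_; _:*_; _:^_; con)

-- Counting in lists

-- The classes by gcd make a loss and a gain in d cancel. Bézout only allows the exponent x to be
-- replaced by gcd (x , n), so one polynomial serves many pairs only when this gcd is fixed, at the
-- price of degree Rd; in return all products fall into n / d residues, and (n / d) · Rd ≤ Rp is
-- free of d. The shift k appears because n ≡ -1 (mod p): the carry of a congruence modulo n, of
-- size at most R, survives as a small constant modulo p. The size of R balances two terms. The
-- coincidences of a pair with itself give |A| ≪ p / R, while the roughly 2R³ triples (a , b , k)
-- with at most Rd roots each give |A| ≪ p^(1/2) R; these agree at R = p^(1/4). The resulting
-- exponent 3/4 leaves 11/12 - 3/4 = 1/6 for the number of divisors. No roots are ever taken: every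
-- bound is kept as an inequality between integer powers.

private variable
  A B K : Set
  xs ys : List A

-- Common source of the pigeonhole inequality `unique-⊆⇒length≤` and of its equality case
-- `unique-⊆⇒↭`, on which Fermat's theorem rests.
unique-⊆⇒↭++ : Unique xs → (∀ {x} → x ∈ xs → x ∈ ys) → ∃[ zs ] ys ↭ xs ++ zs
unique-⊆⇒↭++ {xs = []} {ys} _ _ = ys , ↭-refl
unique-⊆⇒↭++ {xs = x ∷ xs} u@(_ ∷ u′) xs⊆ys with unique-⊆⇒↭++ u′ (xs⊆ys ∘ there)
... | zs , ys↭ with ∈-++⁻ xs (∈-resp-↭ ys↭ (xs⊆ys (here refl)))
...   | inj₁ x∈xs = contradiction x∈xs (Unique.Unique[x∷xs]⇒x∉xs u)
...   | inj₂ x∈zs with us , vs , refl ← ∈-∃++ x∈zs =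
        us ++ vs , ↭-trans ys↭ (↭-trans (++⁺ˡ xs (shift x us vs)) (shift x xs (us ++ vs)))

unique-⊆⇒length≤ : Unique xs → (∀ {x} → x ∈ xs → x ∈ ys) → length xs ≤ length ys
unique-⊆⇒length≤ {xs = xs} {ys} u xs⊆ys with zs , ys↭ ← unique-⊆⇒↭++ u xs⊆ys = begin
  length xs              ≤⟨ m≤m+n _ _ ⟩
  length xs + length zs  ≡⟨ length-++ xs ⟨
  length (xs ++ zs)      ≡⟨ ↭-length ys↭ ⟨
  length ys              ∎
  where open ≤-Reasoning

unique-⊆⇒↭ : Unique xs → (∀ {x} → x ∈ xs → x ∈ ys) → length ys ≤ length xs → ys ↭ xs
unique-⊆⇒↭ {xs = xs} {ys} u xs⊆ys l with unique-⊆⇒↭++ u xs⊆ys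
... | [] , ys↭ = ↭-trans ys↭ (↭-reflexive (++-identityʳ xs))
... | z ∷ zs , ys↭ = contradiction l (<⇒≱ (begin-strict
  length xs                    <⟨ m<m+n (length xs) (s≤s z≤n) ⟩
  length xs + length (z ∷ zs)  ≡⟨ length-++ xs ⟨
  length (xs ++ z ∷ zs)        ≡⟨ ↭-length ys↭ ⟨
  length ys                    ∎))
  where open ≤-Reasoning

unique-map : (f : A → B) → (∀ {x y} → x ∈ xs → y ∈ xs → f x ≡ f y → x ≡ y) →
             Unique xs → Unique (map f xs)
unique-map {xs = []} f inj [] = []
unique-map {xs = x ∷ xs} f inj (x∉ ∷ u) =
  All.map⁺ (All.tabulate λ y∈ fx≡fy → All.lookup x∉ y∈ (inj (here refl) (there y∈) fx≡fy))
  ∷ unique-map f (λ p q → inj (there p) (there q)) u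

∑ : List A → (A → ℕ) → ℕ
∑ xs f = sum (map f xs)

∑-mono : (xs : List A) {f g : A → ℕ} → (∀ {x} → x ∈ xs → f x ≤ g x) → ∑ xs f ≤ ∑ xs g
∑-mono []       h = z≤n
∑-mono (x ∷ xs) h = +-mono-≤ (h (here refl)) (∑-mono xs (h ∘ there))

∑-const : (xs : List A) (c : ℕ) → ∑ xs (λ _ → c) ≡ length xs * c
∑-const []       c = refl
∑-const (x ∷ xs) c = cong (λ k → c + k) (∑-const xs c)

-- The witness is the largest term, or 0 for the empty list, so it inherits `P`. With `P` a bound on
-- a power of the terms, this bounds the sum without extracting a root.
∑-bounded : (P : ℕ → Set) → P 0 → (xs : List A) {f : A → ℕ} → (∀ {x} → x ∈ xs → P (f x)) →
            ∃[ m ] P m × ∑ xs f ≤ length xs * m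
∑-bounded P p0 [] h = 0 , p0 , z≤n
∑-bounded P p0 (x ∷ xs) {f} h with ∑-bounded P p0 xs (h ∘ there)
... | m , pm , le with ≤-total m (f x)
...   | inj₁ m≤fx = f x , h (here refl) , +-monoʳ-≤ (f x) (≤-trans le (*-monoʳ-≤ (length xs) m≤fx))
...   | inj₂ fx≤m = m , pm , +-mono-≤ fx≤m le

-- Induction on the list: the new cross term 2aS is absorbed by adding up 2a · f y ≤ a² + (f y)²
-- over the tail.
cauchy-schwarz : (xs : List A) (f : A → ℕ) →
                 ∑ xs f * ∑ xs f ≤ length xs * ∑ xs (λ x → f x * f x)
cauchy-schwarz []       f = z≤n
cauchy-schwarz (x ∷ xs) f = begin
  (a + S) * (a + S)                      ≡⟨ expand a S ⟩
  a * a + (S * S + 2 * a * S)            ≤⟨ +-monoʳ-≤ (a * a) (+-mono-≤ (cauchy-schwarz xs f) (cross xs)) ⟩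
  a * a + (l * Q + (l * (a * a) + Q))    ≡⟨ collect a l Q ⟩
  suc l * (a * a + Q)                    ∎
  where
  open ≤-Reasoning
  a = f x
  S = ∑ xs f
  Q = ∑ xs (λ x → f x * f x)
  l = length xs
  expand : ∀ a S → (a + S) * (a + S) ≡ a * a + (S * S + 2 * a * S)
  expand = solve-∀
  collect : ∀ a l Q → a * a + (l * Q + (l * (a * a) + Q)) ≡ suc l * (a * a + Q)
  collect = solve-∀
  amgm≤ : ∀ {a b} → a ≤ b → 2 * a * b ≤ a * a + b * b
  amgm≤ {a} a≤b with c , refl ← m≤n⇒∃[o]m+o≡n a≤b = begin
    2 * a * (a + c)              ≤⟨ m≤m+n _ (c * c) ⟩
    2 * a * (a + c) + c * c      ≡⟨ square a c ⟩
    a * a + (a + c) * (a + c)    ∎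
    where
    square : ∀ a c → 2 * a * (a + c) + c * c ≡ a * a + (a + c) * (a + c)
    square = solve-∀
  amgm : ∀ a b → 2 * a * b ≤ a * a + b * b
  amgm a b with ≤-total a b
  ... | inj₁ a≤b = amgm≤ a≤b
  ... | inj₂ b≤a = subst₂ _≤_ (swap b a) (+-comm (b * b) (a * a)) (amgm≤ b≤a)
    where
    swap : ∀ b a → 2 * b * a ≡ 2 * a * b
    swap = solve-∀
  cross : ∀ ys → 2 * a * ∑ ys f ≤ length ys * (a * a) + ∑ ys (λ x → f x * f x)
  cross []       = ≤-reflexive (*-zeroʳ (2 * a))
  cross (y ∷ ys) = begin
    2 * a * (f y + ∑ ys f)               ≡⟨ *-distribˡ-+ (2 * a) (f y) (∑ ys f) ⟩
    2 * a * f y + 2 * a * ∑ ys f         ≤⟨ +-mono-≤ (amgm a (f y)) (cross ys) ⟩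
    a * a + f y * f y + (length ys * (a * a) + _) ≡⟨ shuffle (a * a) (f y * f y) (length ys * (a * a)) _ ⟩
    _ ∎
    where
    shuffle : ∀ u v w z → u + v + (w + z) ≡ u + w + (v + z)
    shuffle = solve-∀

length-filter-× : {P : A × B → Set} (P? : Decidable P) (xs : List A) (ys : List B) →
  length (filter P? (cartesianProduct xs ys)) ≡ ∑ xs (λ x → length (filter (λ y → P? (x , y)) ys))
length-filter-× P? []       ys = refl
length-filter-× P? (x ∷ xs) ys = begin
  length (filter P? (map (x ,_) ys ++ cartesianProduct xs ys))
    ≡⟨ cong length (filter-++ P? (map (x ,_) ys) _) ⟩
  length (filter P? (map (x ,_) ys) ++ filter P? (cartesianProduct xs ys))
    ≡⟨ length-++ (filter P? (map (x ,_) ys)) ⟩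
  length (filter P? (map (x ,_) ys)) + length (filter P? (cartesianProduct xs ys))
    ≡⟨ cong₂ _+_ (row ys) (length-filter-× P? xs ys) ⟩
  length (filter (λ y → P? (x , y)) ys) + ∑ xs (λ x → length (filter (λ y → P? (x , y)) ys)) ∎
  where
  open ≡-Reasoning
  row : ∀ ys → length (filter P? (map (x ,_) ys)) ≡ length (filter (λ y → P? (x , y)) ys)
  row []       = refl
  row (y ∷ ys) with P? (x , y)
  ... | yes _ = cong suc (row ys)
  ... | no  _ = row ys

double-counting : {R : A → B → Set} (R? : ∀ a b → Dec (R a b)) (xs : List A) (ys : List B) →
  ∑ xs (λ x → length (filter (R? x) ys)) ≡ ∑ ys (λ y → length (filter (λ x → R? x y) xs))
double-counting R? [] ys = sym (trans (∑-const ys 0) (*-zeroʳ (length ys)))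
double-counting R? (x ∷ xs) ys = trans (cong (λ k → length (filter (R? x) ys) + k) (double-counting R? xs ys)) (add ys)
  where
  col = λ y → length (filter (λ x → R? x y) xs)
  add : ∀ ys → length (filter (R? x) ys) + ∑ ys col
             ≡ ∑ ys (λ y → length (filter (λ x → R? x y) (x ∷ xs)))
  add [] = refl
  add (y ∷ ys) with R? x y
  ... | yes _ = cong suc (trans (x+[y+z]≡y+[x+z] (length (filter (R? x) ys)) (col y) (∑ ys col)) (cong (λ k → col y + k) (add ys)))
  ... | no  _ = trans (x+[y+z]≡y+[x+z] (length (filter (R? x) ys)) (col y) (∑ ys col)) (cong (λ k → col y + k) (add ys))

-- A covering suffices: the fibres may overlap, as each element only has to be counted at least
-- once.
length≤∑-fibres : {R : K → A → Set} (R? : ∀ k a → Dec (R k a)) (ks : List K) (xs : List A) →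
  (∀ {x} → x ∈ xs → ∃[ k ] k ∈ ks × R k x) → length xs ≤ ∑ ks (λ k → length (filter (R? k) xs))
length≤∑-fibres R? ks xs h = begin
  length xs                                          ≡⟨ *-identityʳ _ ⟨
  length xs * 1                                      ≡⟨ ∑-const xs 1 ⟨
  ∑ xs (λ _ → 1)                                     ≤⟨ ∑-mono xs (λ {x} x∈ → let k , k∈ , r = h x∈ in ∈-length (∈-filter⁺ (λ k → R? k x) k∈ r)) ⟩
  ∑ xs (λ x → length (filter (λ k → R? k x) ks))     ≡⟨ double-counting R? ks xs ⟨
  ∑ ks (λ k → length (filter (R? k) xs))             ∎
  where open ≤-Reasoning

∑-fibres≤length : (key : A → ℕ) (ks : List ℕ) → Unique ks → (xs : List A) →
  ∑ ks (λ k → length (filter (λ x → key x ≟ k) xs)) ≤ length xs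
∑-fibres≤length key ks u xs = begin
  ∑ ks (λ k → length (filter (λ x → key x ≟ k) xs))  ≡⟨ double-counting (λ k x → key x ≟ k) ks xs ⟩
  ∑ xs (λ x → length (filter (λ k → key x ≟ k) ks))  ≤⟨ ∑-mono xs (λ {x} _ → atMostOne x) ⟩
  ∑ xs (λ _ → 1)                                     ≡⟨ ∑-const xs 1 ⟩
  length xs * 1                                      ≡⟨ *-identityʳ _ ⟩
  length xs                                          ∎
  where
  open ≤-Reasoning
  atMostOne : ∀ x → length (filter (λ k → key x ≟ k) ks) ≤ 1
  atMostOne x = unique-⊆⇒length≤ {ys = key x ∷ []} (Unique.filter⁺ _ u)
    λ k∈ → here (sym (proj₂ (∈-filter⁻ (λ k → key x ≟ k) {xs = ks} k∈)))

length-× : (xs : List A) (ys : List B) → length (cartesianProduct xs ys) ≡ length xs * length ys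
length-× []       ys = refl
length-× (x ∷ xs) ys = trans (length-++ (map (x ,_) ys)) (cong₂ _+_ (length-map (x ,_) ys) (length-× xs ys))

sameKey? : (key : A → ℕ) → (st : A × A) → Dec (key (proj₁ st) ≡ key (proj₂ st))
sameKey? key (s , t) = key s ≟ key t

-- Cauchy-Schwarz over the keys: a fibre of size m contributes its m² ordered pairs, diagonal
-- included, and pairs from different fibres are different.
length²≤keys*collisions : (key : A → ℕ) (ks : List ℕ) → Unique ks → (xs : List A) → Unique xs →
  (∀ {x} → x ∈ xs → key x ∈ ks) →
  length xs * length xs ≤ length ks * length (filter (sameKey? key) (cartesianProduct xs xs))
length²≤keys*collisions key ks uk xs ux key∈ = begin
  length xs * length xs                      ≤⟨ *-mono-≤ le le ⟩
  ∑ ks fibre# * ∑ ks fibre#                  ≤⟨ cauchy-schwarz ks fibre# ⟩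
  length ks * ∑ ks (λ k → fibre# k * fibre# k) ≤⟨ *-monoʳ-≤ (length ks) (∑-mono ks (λ {k} _ → square k)) ⟩
  length ks * ∑ ks (λ k → length (filter (λ st → key (proj₁ st) ≟ k) T))
                                             ≤⟨ *-monoʳ-≤ (length ks) (∑-fibres≤length (key ∘ proj₁) ks uk T) ⟩
  length ks * length T                       ∎
  where
  open ≤-Reasoning
  T = filter (sameKey? key) (cartesianProduct xs xs)
  fibre = λ k → filter (λ x → key x ≟ k) xs
  fibre# = λ k → length (fibre k)
  le : length xs ≤ ∑ ks fibre#
  le = length≤∑-fibres (λ k x → key x ≟ k) ks xs (λ {x} x∈ → key x , key∈ x∈ , refl)
  square : ∀ k → fibre# k * fibre# k ≤ length (filter (λ st → key (proj₁ st) ≟ k) T)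
  square k = subst (_≤ length (filter (λ st → key (proj₁ st) ≟ k) T)) (length-× (fibre k) (fibre k)) (unique-⊆⇒length≤ {xs = cartesianProduct (fibre k) (fibre k)}
    (Unique.cartesianProduct⁺ (Unique.filter⁺ _ ux) (Unique.filter⁺ _ ux))
    λ st∈ → let s∈ , t∈ = ∈-cartesianProduct⁻ (fibre k) (fibre k) st∈
                s∈xs , ks≡ = ∈-filter⁻ (λ x → key x ≟ k) {xs = xs} s∈
                t∈xs , kt≡ = ∈-filter⁻ (λ x → key x ≟ k) {xs = xs} t∈
            in ∈-filter⁺ (λ st → key (proj₁ st) ≟ k)
                 (∈-filter⁺ (sameKey? key) (∈-cartesianProduct⁺ s∈xs t∈xs) (trans ks≡ (sym kt≡))) ks≡)

-- The divisor function

∈-range⁺ : ∀ {i n} → 1 ≤ i → i ≤ n → i ∈ range n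
∈-range⁺ {suc i} _ i<n = ∈-map⁺ suc (∈-upTo⁺ i<n)

∈-range⁻ : ∀ {i n} → i ∈ range n → 1 ≤ i × i ≤ n
∈-range⁻ i∈ with _ , j∈ , refl ← ∈-map⁻ suc i∈ = s≤s z≤n , ∈-upTo⁻ j∈

range-unique : ∀ n → Unique (range n)
range-unique n = Unique.map⁺ suc-injective (Unique.upTo⁺ n)

length-range : ∀ n → length (range n) ≡ n
length-range n = trans (length-map suc (upTo n)) (length-upTo n)

divisors : ℕ → List ℕ
divisors n = filter (_∣? n) (range n)

τ : ℕ → ℕ
τ n = length (divisors n)

∈-divisors⁺ : ∀ {d n} .{{_ : NonZero n}} → d ∣ n → d ∈ divisors n
∈-divisors⁺ {zero}  {suc n} d∣n = contradiction (0∣⇒≡0 d∣n) λ ()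
∈-divisors⁺ {suc d} {n}     d∣n = ∈-filter⁺ (_∣? n) (∈-range⁺ (s≤s z≤n) (∣⇒≤ d∣n)) d∣n

∈-divisors⁻ : ∀ {d} n → d ∈ divisors n → d ∣ n
∈-divisors⁻ n d∈ = proj₂ (∈-filter⁻ (_∣? n) {xs = range n} d∈)

prime∤⇒coprime : ∀ {q d} → Prime q → q ∤ d → Coprime d q
prime∤⇒coprime pq q∤d (e∣d , e∣q) with prime⇒irreducible pq e∣q
... | inj₁ e≡1  = e≡1
... | inj₂ refl = contradiction e∣d q∤d

-- Divisors prime to q land among those of m, the others are q times a divisor of l. Leaving m free
-- covers both uses: m = l gives the factor 2 for a large prime, and m the cofactor of a power of q
-- gives one step of the factor k + 1.
τ-prime-* : ∀ {q} (l m : ℕ) .{{_ : NonZero l}} .{{_ : NonZero m}} → Prime q →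
            (∀ {d} → q ∤ d → d ∣ q * l → d ∣ m) → τ (q * l) ≤ τ m + τ l
τ-prime-* {q} l m pq h = begin
  τ (q * l)                                         ≤⟨ unique-⊆⇒length≤ {ys = divisors m ++ map (q *_) (divisors l)} (Unique.filter⁺ (_∣? q * l) (range-unique (q * l))) (split ∘ ∈-divisors⁻ (q * l)) ⟩
  length (divisors m ++ map (q *_) (divisors l))    ≡⟨ length-++ (divisors m) ⟩
  τ m + length (map (q *_) (divisors l))            ≡⟨ cong (λ k → τ m + k) (length-map (q *_) (divisors l)) ⟩
  τ m + τ l                                         ∎
  where
  open ≤-Reasoning
  instance _ = prime⇒nonZero pq
  split : ∀ {d} → d ∣ q * l → d ∈ divisors m ++ map (q *_) (divisors l)
  split {d} d∣ql with q ∣? d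
  ... | no q∤d = ∈-++⁺ˡ (∈-divisors⁺ (h q∤d d∣ql))
  ... | yes (divides e refl) = ∈-++⁺ʳ (divisors m) (subst (_∈ map (q *_) (divisors l)) (*-comm q e)
          (∈-map⁺ (q *_) (∈-divisors⁺ (*-cancelˡ-∣ q (subst (_∣ q * l) (*-comm e q) d∣ql)))))

τ-prime-^-* : ∀ {q} (k m : ℕ) .{{_ : NonZero m}} → Prime q → τ (q ^ k * m) ≤ suc k * τ m
τ-prime-^-* {q} zero m pq = subst (λ n → τ n ≤ τ m + 0) (sym (*-identityˡ m)) (≤-reflexive (sym (+-identityʳ (τ m))))
τ-prime-^-* {q} (suc k) m pq = begin
  τ (q * q ^ k * m)      ≡⟨ cong τ (*-assoc q (q ^ k) m) ⟩
  τ (q * (q ^ k * m))    ≤⟨ τ-prime-* (q ^ k * m) m pq (λ q∤d d∣ → strip k q∤d (coprime-divisor (prime∤⇒coprime pq q∤d) d∣)) ⟩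
  τ m + τ (q ^ k * m)    ≤⟨ +-monoʳ-≤ (τ m) (τ-prime-^-* k m pq) ⟩
  τ m + suc k * τ m      ∎
  where
  open ≤-Reasoning
  instance
    _ = prime⇒nonZero pq
    _ = m^n≢0 q k
    _ = m*n≢0 (q ^ k) m
  strip : ∀ k {d} → q ∤ d → d ∣ q ^ k * m → d ∣ m
  strip zero    q∤d d∣ = subst (_ ∣_) (*-identityˡ m) d∣
  strip (suc k) {d} q∤d d∣ = strip k q∤d (coprime-divisor (prime∤⇒coprime pq q∤d) (subst (d ∣_) (*-assoc q (q ^ k) m) d∣))

^-distribʳ-* : ∀ m n r → (m * n) ^ r ≡ m ^ r * n ^ r
^-distribʳ-* m n zero    = refl
^-distribʳ-* m n (suc r) = trans (cong (m * n *_) (^-distribʳ-* m n r)) (interchange m n (m ^ r) (n ^ r))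

n<2^n : ∀ n → n < 2 ^ n
n<2^n zero    = s≤s z≤n
n<2^n (suc n) = begin-strict
  suc n            <⟨ s≤s (n<2^n n) ⟩
  1 + 2 ^ n        ≤⟨ +-monoˡ-≤ (2 ^ n) (m^n>0 2 n) ⟩
  2 ^ n + 2 ^ n    ≡⟨ cong (λ k → 2 ^ n + k) (+-identityʳ (2 ^ n)) ⟨
  2 * 2 ^ n        ∎
  where open ≤-Reasoning

-- Write k = s + t r with s < r, so that 1 + k ≤ r (1 + t) ≤ r 2ᵗ.
[1+k]^r≤r^r*2^k : ∀ r k .{{_ : NonZero r}} → suc k ^ r ≤ r ^ r * 2 ^ k
[1+k]^r≤r^r*2^k r k = begin
  suc k ^ r              ≤⟨ ^-monoˡ-≤ r 1+k≤ ⟩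
  (r * 2 ^ t) ^ r        ≡⟨ ^-distribʳ-* r (2 ^ t) r ⟩
  r ^ r * (2 ^ t) ^ r    ≡⟨ cong (r ^ r *_) (^-*-assoc 2 t r) ⟩
  r ^ r * 2 ^ (t * r)    ≤⟨ *-monoʳ-≤ (r ^ r) (^-monoʳ-≤ 2 tr≤k) ⟩
  r ^ r * 2 ^ k          ∎
  where
  open ≤-Reasoning
  t = k / r
  tr≤k : t * r ≤ k
  tr≤k = subst (t * r ≤_) (sym (m≡m%n+[m/n]*n k r)) (m≤n+m _ (k % r))
  1+k≤ : suc k ≤ r * 2 ^ t
  1+k≤ = begin
    suc k                ≡⟨ cong suc (m≡m%n+[m/n]*n k r) ⟩
    suc (k % r) + t * r  ≤⟨ +-monoˡ-≤ (t * r) (m%n<n k r) ⟩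
    suc t * r            ≡⟨ *-comm (suc t) r ⟩
    r * suc t            ≤⟨ *-monoʳ-≤ r (n<2^n t) ⟩
    r * 2 ^ t            ∎

τ-product-large-primes : ∀ r {qs} → All Prime qs → All (2 ^ r ≤_) qs → τ (product qs) ^ r ≤ product qs
τ-product-large-primes r [] [] = ≤-reflexive (^-zeroˡ r)
τ-product-large-primes r {q ∷ qs} (pq ∷ pqs) (2^r≤q ∷ ls) = begin
  τ (q * product qs) ^ r           ≤⟨ ^-monoˡ-≤ r (τ-prime-* (product qs) (product qs) pq (λ q∤d → coprime-divisor (prime∤⇒coprime pq q∤d))) ⟩
  (τ (product qs) + τ (product qs)) ^ r   ≡⟨ cong (λ x → (τ (product qs) + x) ^ r) (+-identityʳ _) ⟨
  (2 * τ (product qs)) ^ r         ≡⟨ ^-distribʳ-* 2 (τ (product qs)) r ⟩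
  2 ^ r * τ (product qs) ^ r       ≤⟨ *-mono-≤ 2^r≤q (τ-product-large-primes r pqs ls) ⟩
  q * product qs                   ∎
  where
  open ≤-Reasoning
  instance _ = productOfPrimes≢0 pqs

-- A prime factor q ≥ 2ʳ costs a factor 2 ≤ q^(1/r) in τ, and each of the finitely many
-- primes below 2ʳ costs a bounded constant, so the roughness is lowered from 2ʳ to 2 stepwise.
τ^_-Bounded-On_-Rough : ℕ → ℕ → Set
τ^ r -Bounded-On b -Rough = ∃[ C ] (∀ n .{{_ : NonZero n}} → b Rough n → τ n ^ r ≤ C * n)

τ-bounded-very-rough : ∀ r → τ^ r -Bounded-On (2 ^ r) -Rough
τ-bounded-very-rough r = 1 , λ n rough →
  let open PrimeFactorisation (factorise n)
      large = All.tabulate λ {q} q∈ → ≮⇒≥ λ q<2^r → rough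
        (hasNonTrivialDivisor {divisor = q} {{prime⇒nonTrivial (All.lookup factorsPrime q∈)}} q<2^r
          (subst (q ∣_) (sym isFactorisation) (∈⇒∣product q∈)))
  in subst₂ _≤_ (cong (λ m → τ m ^ r) (sym isFactorisation)) (trans (sym isFactorisation) (sym (*-identityˡ n)))
       (τ-product-large-primes r factorsPrime large)

factor-out : ∀ b n .{{_ : NonTrivial b}} .{{_ : NonZero n}} → ∃[ k ] ∃[ m ] n ≡ b ^ k * m × b ∤ m
factor-out b n = go n (<-wellFounded n)
  where
  go : ∀ n .{{_ : NonZero n}} → Acc _<_ n → ∃[ k ] ∃[ m ] n ≡ b ^ k * m × b ∤ m
  go n (acc rs) with b ∣? n
  ... | no b∤n = 0 , n , sym (*-identityˡ n) , b∤n
  ... | yes b∣n@(divides q n≡q*b) with go q {{≢-nonZero λ q≡0 → ≢-nonZero⁻¹ n (trans n≡q*b (cong (_* b) q≡0))}} (rs (quotient-< b∣n))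
  ...   | k , m , refl , b∤m = suc k , m , trans n≡q*b (trans (*-comm _ b) (sym (*-assoc b (b ^ k) m))) , b∤m

-- The primality of b is never tested: if k ≥ 1, then b divides a b-rough number and is therefore
-- prime, and if k = 0, there is nothing to split off. The cofactor m is rough for b + 1, and (1 +
-- k)^r is paid for by r^r and the factor b^k ≥ 2^k of n.
τ-bounded-rough-step : ∀ r b .{{_ : NonZero r}} .{{_ : NonTrivial b}} →
  τ^ r -Bounded-On suc b -Rough → τ^ r -Bounded-On b -Rough
τ-bounded-rough-step r b (C , bound) = r ^ r * C , go
  where
  open ≤-Reasoning
  instance _ = nonTrivial⇒nonZero b
  τ≤ : ∀ k m .{{_ : NonZero m}} → b Rough (b ^ k * m) → τ (b ^ k * m) ≤ suc k * τ m
  τ≤ zero    m _ = ≤-reflexive (trans (cong τ (*-identityˡ m)) (sym (*-identityˡ (τ m))))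
  τ≤ (suc k) m rough = τ-prime-^-* (suc k) m (rough∧∣⇒prime rough (∣m⇒∣m*n m (m∣m*n (b ^ k))))
  go : ∀ n .{{_ : NonZero n}} → b Rough n → τ n ^ r ≤ r ^ r * C * n
  go n rough with k , m , refl , b∤m ← factor-out b n = begin
    τ (b ^ k * m) ^ r                 ≤⟨ ^-monoˡ-≤ r (τ≤ k m rough) ⟩
    (suc k * τ m) ^ r                 ≡⟨ ^-distribʳ-* (suc k) (τ m) r ⟩
    suc k ^ r * τ m ^ r               ≤⟨ *-mono-≤ ([1+k]^r≤r^r*2^k r k) (bound m (∤⇒rough-suc b∤m (rough∧∣⇒rough rough (n∣m*n (b ^ k))))) ⟩
    r ^ r * 2 ^ k * (C * m)           ≤⟨ *-monoˡ-≤ (C * m) (*-monoʳ-≤ (r ^ r) (^-monoˡ-≤ k (nonTrivial⇒n>1 b))) ⟩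
    r ^ r * b ^ k * (C * m)           ≡⟨ interchange (r ^ r) (b ^ k) C m ⟩
    r ^ r * C * (b ^ k * m)           ∎
    where
    instance _ = m*n≢0⇒n≢0 (b ^ k) {m}

abstract
  τ-bounded : ∀ r .{{_ : NonZero r}} → ∃[ C ] (∀ n .{{_ : NonZero n}} → τ n ^ r ≤ C * n)
  -- The descent from 2^r stops at 2, where roughness holds for every n; r ≥ 1 ensures that 2^r is
  -- of the form 2 + j.
  τ-bounded r with j , 2+j≡2^r ← m≤n⇒∃[o]m+o≡n (^-monoʳ-≤ 2 (>-nonZero⁻¹ r)) =
    let C , bound = descend j (subst (τ^ r -Bounded-On_-Rough) (sym 2+j≡2^r) (τ-bounded-very-rough r))
    in C , λ n → bound n 2-rough
    where
    descend : ∀ j → τ^ r -Bounded-On (2 + j) -Rough → τ^ r -Bounded-On 2 -Rough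
    descend zero    h = h
    descend (suc j) h = descend j (τ-bounded-rough-step r (2 + j) h)

-- Polynomials and congruences

-- A function ℤ → ℤ is given by a polynomial of degree at most n + 1 when all its
-- difference quotients are polynomials of degree at most n.
Degree≤ : ℕ → (ℤ → ℤ) → Set
Degree≤ zero    f = ∀ x → f x ≡ f 0ℤ
Degree≤ (suc n) f = ∀ r → ∃[ g ] Degree≤ n g × (∀ x → f x ≡ f r ℤ.+ (x ℤ.- r) ℤ.* g x)

degree-const : ∀ n c → Degree≤ n (λ _ → c)
degree-const zero    c x = refl
degree-const (suc n) c r = (λ _ → 0ℤ) , degree-const n 0ℤ , λ x → lemma c (x ℤ.- r)
  where
  lemma : ∀ c d → c ≡ c ℤ.+ d ℤ.* 0ℤ
  lemma = ℤ.solve-∀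

degree-suc : ∀ n {f} → Degree≤ n f → Degree≤ (suc n) f
degree-suc zero    {f} h r = (λ _ → 0ℤ) , (λ _ → refl) , λ x →
  trans (trans (h x) (sym (h r))) (lemma (f r) (x ℤ.- r))
  where
  lemma : ∀ c d → c ≡ c ℤ.+ d ℤ.* 0ℤ
  lemma = ℤ.solve-∀
degree-suc (suc n) h r = let g , dg , eq = h r in g , degree-suc n dg , eq

degree-mono : ∀ {m n f} → m ≤ n → Degree≤ m f → Degree≤ n f
degree-mono {m} {f = f} m≤n h with k , refl ← m≤n⇒∃[o]m+o≡n m≤n = go k
  where
  go : ∀ k → Degree≤ (m + k) f
  go zero    = subst (λ n → Degree≤ n f) (sym (+-identityʳ m)) h
  go (suc k) = subst (λ n → Degree≤ n f) (sym (+-suc m k)) (degree-suc (m + k) (go k))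

degree-+ : ∀ n {f g} → Degree≤ n f → Degree≤ n g → Degree≤ n (λ x → f x ℤ.+ g x)
degree-+ zero    hf hg x = cong₂ ℤ._+_ (hf x) (hg x)
degree-+ (suc n) {f} {g} hf hg r =
  let f′ , df , ef = hf r ; g′ , dg , eg = hg r in
  (λ x → f′ x ℤ.+ g′ x) , degree-+ n df dg , λ x →
    trans (cong₂ ℤ._+_ (ef x) (eg x)) (lemma (f r) (g r) (x ℤ.- r) (f′ x) (g′ x))
  where
  lemma : ∀ a b d u v → (a ℤ.+ d ℤ.* u) ℤ.+ (b ℤ.+ d ℤ.* v) ≡ (a ℤ.+ b) ℤ.+ d ℤ.* (u ℤ.+ v)
  lemma = ℤ.solve-∀

degree-scale : ∀ n c {f} → Degree≤ n f → Degree≤ n (λ x → c ℤ.* f x)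
degree-scale zero    c h x = cong (c ℤ.*_) (h x)
degree-scale (suc n) c {f} h r =
  let g , dg , eq = h r in
  (λ x → c ℤ.* g x) , degree-scale n c dg , λ x → trans (cong (c ℤ.*_) (eq x)) (lemma c (f r) (x ℤ.- r) (g x))
  where
  lemma : ∀ c a d u → c ℤ.* (a ℤ.+ d ℤ.* u) ≡ c ℤ.* a ℤ.+ d ℤ.* (c ℤ.* u)
  lemma = ℤ.solve-∀

-- Product rule: if g is the difference quotient of f at r, that of the product is a · f x + (a r +
-- k) · g x. Linear factors are enough, since both sides of the equation to be studied are constants
-- times powers of linear forms.
degree-linear-* : ∀ n a k {f} → Degree≤ n f → Degree≤ (suc n) (λ x → (a ℤ.* x ℤ.+ k) ℤ.* f x)
degree-linear-* zero a k {f} h r =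
  (λ _ → a ℤ.* f 0ℤ) , (λ _ → refl) , λ x →
    trans (cong ((a ℤ.* x ℤ.+ k) ℤ.*_) (h x))
      (trans (lemma a k x r (f 0ℤ))
        (cong (λ v → (a ℤ.* r ℤ.+ k) ℤ.* v ℤ.+ (x ℤ.- r) ℤ.* (a ℤ.* f 0ℤ)) (sym (h r))))
  where
  lemma : ∀ a k x r c → (a ℤ.* x ℤ.+ k) ℤ.* c ≡ (a ℤ.* r ℤ.+ k) ℤ.* c ℤ.+ (x ℤ.- r) ℤ.* (a ℤ.* c)
  lemma = ℤ.solve-∀
degree-linear-* (suc n) a k {f} h r =
  let g , dg , eq = h r in
  (λ x → a ℤ.* f x ℤ.+ (a ℤ.* r ℤ.+ k) ℤ.* g x) ,
  degree-+ (suc n) (degree-scale (suc n) a h) (degree-scale (suc n) (a ℤ.* r ℤ.+ k) (degree-suc n dg)) , λ x →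
    trans (split a k x r (f x))
      (trans (cong (λ v → (a ℤ.* r ℤ.+ k) ℤ.* v ℤ.+ (x ℤ.- r) ℤ.* (a ℤ.* f x)) (eq x))
             (collect a (a ℤ.* r ℤ.+ k) (x ℤ.- r) (f r) (f x) (g x)))
  where
  split : ∀ a k x r c → (a ℤ.* x ℤ.+ k) ℤ.* c ≡ (a ℤ.* r ℤ.+ k) ℤ.* c ℤ.+ (x ℤ.- r) ℤ.* (a ℤ.* c)
  split = ℤ.solve-∀
  collect : ∀ a l d c e u → l ℤ.* (c ℤ.+ d ℤ.* u) ℤ.+ d ℤ.* (a ℤ.* e) ≡ l ℤ.* c ℤ.+ d ℤ.* (a ℤ.* e ℤ.+ l ℤ.* u)
  collect = ℤ.solve-∀

degree-linear-^ : ∀ a k n → Degree≤ n (λ x → (a ℤ.* x ℤ.+ k) ℤ.^ n)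
degree-linear-^ a k zero    = degree-const 0 1ℤ
degree-linear-^ a k (suc n) = degree-linear-* n a k (degree-linear-^ a k n)

degree-cong : ∀ n {f g} → (∀ x → f x ≡ g x) → Degree≤ n f → Degree≤ n g
degree-cong zero    f≗g h x = trans (sym (f≗g x)) (trans (h x) (f≗g 0ℤ))
degree-cong (suc n) f≗g h r = let f′ , df , eq = h r in
  f′ , df , λ x → trans (sym (f≗g x)) (trans (eq x) (cong (ℤ._+ (x ℤ.- r) ℤ.* f′ x) (f≗g r)))

degree-^ : ∀ n → Degree≤ n (ℤ._^ n)
degree-^ n = degree-cong n (λ x → cong (ℤ._^ n) (lemma x)) (degree-linear-^ 1ℤ 0ℤ n)
  where
  lemma : ∀ x → 1ℤ ℤ.* x ℤ.+ 0ℤ ≡ x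
  lemma = ℤ.solve-∀

0ℤ^n≡0ℤ : ∀ n .{{_ : NonZero n}} → 0ℤ ℤ.^ n ≡ 0ℤ
0ℤ^n≡0ℤ (suc n) = refl

∣+m-+n∣ : ∀ m n → ∣ + m ℤ.- + n ∣ ≡ ℕ.∣ m - n ∣
∣+m-+n∣ m n = trans (cong ∣_∣ (ℤ.m-n≡m⊖n m n)) (go m n)
  where
  go : ∀ m n → ∣ m ℤ.⊖ n ∣ ≡ ℕ.∣ m - n ∣
  go m n with ≤-total m n
  ... | inj₁ m≤n = trans (ℤ.∣⊖∣-≤ m≤n) (sym (m≤n⇒∣m-n∣≡n∸m m≤n))
  ... | inj₂ n≤m = trans (ℤ.∣m⊖n∣≡∣n⊖m∣ m n) (trans (ℤ.∣⊖∣-≤ n≤m) (sym (m≤n⇒∣n-m∣≡n∸m n≤m)))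

pos-^ : ∀ m n → + (m ^ n) ≡ (+ m) ℤ.^ n
pos-^ m zero    = refl
pos-^ m (suc n) = trans (ℤ.pos-* m (m ^ n)) (cong (+ m ℤ.*_) (pos-^ m n))

^-distribʳ-*ℤ : ∀ i j n → (i ℤ.* j) ℤ.^ n ≡ i ℤ.^ n ℤ.* j ℤ.^ n
^-distribʳ-*ℤ i j zero    = refl
^-distribʳ-*ℤ i j (suc n) = trans (cong (i ℤ.* j ℤ.*_) (^-distribʳ-*ℤ i j n)) (lemma i j (i ℤ.^ n) (j ℤ.^ n))
  where
  lemma : ∀ i j u v → (i ℤ.* j) ℤ.* (u ℤ.* v) ≡ (i ℤ.* u) ℤ.* (j ℤ.* v)
  lemma = ℤ.solve-∀

-- Arithmetic and roots of polynomials modulo a prime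

module Modulo (p : ℕ) (p-prime : Prime p) where

  infix 4 _≈_ _≉_

  record _≈_ (i j : ℤ) : Set where
    constructor congruent
    field ∣-difference : + p ℤ∣.∣ i ℤ.- j

  open _≈_ public

  _≉_ : ℤ → ℤ → Set
  i ≉ j = ¬ i ≈ j

  private instance _ = prime⇒nonZero p-prime

  ≈-reflexive : ∀ {i j} → i ≡ j → i ≈ j
  ≈-reflexive {i} refl = congruent (ℤ∣.divides 0ℤ (ℤ.+-inverseʳ i))

  ≈-refl : ∀ {i} → i ≈ i
  ≈-refl = ≈-reflexive refl

  ≈-sym : ∀ {i j} → i ≈ j → j ≈ i
  ≈-sym {i} {j} (congruent i≈j) = congruent (subst (+ p ℤ∣.∣_) (lemma i j) (ℤ∣.∣m⇒∣-m i≈j))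
    where
    lemma : ∀ i j → ℤ.- (i ℤ.- j) ≡ j ℤ.- i
    lemma = ℤ.solve-∀

  ≈-trans : ∀ {i j k} → i ≈ j → j ≈ k → i ≈ k
  ≈-trans {i} {j} {k} (congruent i≈j) (congruent j≈k) = congruent (subst (+ p ℤ∣.∣_) (lemma i j k) (ℤ∣.∣m∣n⇒∣m+n i≈j j≈k))
    where
    lemma : ∀ i j k → (i ℤ.- j) ℤ.+ (j ℤ.- k) ≡ i ℤ.- k
    lemma = ℤ.solve-∀

  ≈-setoid : Setoid _ _
  ≈-setoid = record { _≈_ = _≈_ ; isEquivalence = record { refl = ≈-refl ; sym = ≈-sym ; trans = ≈-trans } }

  open import Relation.Binary.Reasoning.Setoid ≈-setoid

  ≈-*-cong : ∀ {i j k l} → i ≈ j → k ≈ l → i ℤ.* k ≈ j ℤ.* l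
  ≈-*-cong {i} {j} {k} {l} (congruent i≈j) (congruent k≈l) = congruent (subst (+ p ℤ∣.∣_) (lemma i j k l)
    (ℤ∣.∣m∣n⇒∣m+n (ℤ∣.∣m⇒∣m*n k i≈j) (ℤ∣.∣n⇒∣m*n j k≈l)))
    where
    lemma : ∀ i j k l → (i ℤ.- j) ℤ.* k ℤ.+ j ℤ.* (k ℤ.- l) ≡ i ℤ.* k ℤ.- j ℤ.* l
    lemma = ℤ.solve-∀

  ≈-^-cong : ∀ {i j} n → i ≈ j → i ℤ.^ n ≈ j ℤ.^ n
  ≈-^-cong zero    i≈j = ≈-refl
  ≈-^-cong (suc n) i≈j = ≈-*-cong i≈j (≈-^-cong n i≈j)

  ∣⇒≈0 : ∀ {i} → + p ℤ∣.∣ i → i ≈ 0ℤ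
  ∣⇒≈0 {i} = congruent ∘ subst (+ p ℤ∣.∣_) (sym (ℤ.+-identityʳ i))

  ≈0⇒∣ : ∀ {i} → i ≈ 0ℤ → + p ℤ∣.∣ i
  ≈0⇒∣ {i} = subst (+ p ℤ∣.∣_) (ℤ.+-identityʳ i) ∘ ∣-difference

  i*j≈0⇒i≈0∨j≈0 : ∀ i j → i ℤ.* j ≈ 0ℤ → i ≈ 0ℤ ⊎ j ≈ 0ℤ
  i*j≈0⇒i≈0∨j≈0 i j h with euclidsLemma ∣ i ∣ ∣ j ∣ p-prime (subst (p ∣_) (ℤ.abs-* i j) (ℤ∣.∣⇒∣ᵤ (≈0⇒∣ h)))
  ... | inj₁ p∣i = inj₁ (∣⇒≈0 (ℤ∣.∣ᵤ⇒∣ p∣i))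
  ... | inj₂ p∣j = inj₂ (∣⇒≈0 (ℤ∣.∣ᵤ⇒∣ p∣j))

  ≈-*-cancelˡ : ∀ {c i j} → c ≉ 0ℤ → c ℤ.* i ≈ c ℤ.* j → i ≈ j
  ≈-*-cancelˡ {c} {i} {j} c≉0 h with i*j≈0⇒i≈0∨j≈0 c (i ℤ.- j) (∣⇒≈0 (subst (+ p ℤ∣.∣_) (lemma c i j) (∣-difference h)))
    where
    lemma : ∀ c i j → c ℤ.* i ℤ.- c ℤ.* j ≡ c ℤ.* (i ℤ.- j)
    lemma = ℤ.solve-∀
  ... | inj₁ c≈0 = contradiction c≈0 c≉0
  ... | inj₂ i≈j = congruent (≈0⇒∣ i≈j)

  1≉0 : 1ℤ ≉ 0ℤ
  1≉0 h = ¬prime[1] (subst Prime (∣1⇒≡1 (ℤ∣.∣⇒∣ᵤ (≈0⇒∣ h))) p-prime)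

  ^-≉0 : ∀ {i} n → i ≉ 0ℤ → i ℤ.^ n ≉ 0ℤ
  ^-≉0     zero    i≉0 = 1≉0
  ^-≉0 {i} (suc n) i≉0 h with i*j≈0⇒i≈0∨j≈0 i (i ℤ.^ n) h
  ... | inj₁ i≈0  = i≉0 i≈0
  ... | inj₂ iⁿ≈0 = ^-≉0 n i≉0 iⁿ≈0

  *-≉0 : ∀ {i j} → i ≉ 0ℤ → j ≉ 0ℤ → i ℤ.* j ≉ 0ℤ
  *-≉0 {i} {j} i≉0 j≉0 h with i*j≈0⇒i≈0∨j≈0 i j h
  ... | inj₁ i≈0 = i≉0 i≈0
  ... | inj₂ j≈0 = j≉0 j≈0

  small≉0 : ∀ i .{{i≢0 : ℤ.NonZero i}} → ∣ i ∣ < p → i ≉ 0ℤ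
  small≉0 i {{i≢0}} i<p h = >⇒∤ {{i≢0}} i<p (ℤ∣.∣⇒∣ᵤ (≈0⇒∣ h))

  pos≉0 : ∀ {m} → 1 ≤ m → m < p → + m ≉ 0ℤ
  pos≉0 {suc m} _ m<p = small≉0 (+ suc m) m<p

  pos-≈⇒≡ : ∀ {m n} → m < p → n < p → + m ≈ + n → m ≡ n
  pos-≈⇒≡ {m} {n} m<p n<p h with + m ℤ.- + n in eq
  ... | i with i ℤ.≟ 0ℤ
  ...   | yes refl = ℤ.+-injective (ℤ.i-j≡0⇒i≡j (+ m) (+ n) eq)
  ...   | no  i≢0  = contradiction (∣⇒≈0 (subst (+ p ℤ∣.∣_) eq (∣-difference h))) (small≉0 i {{ℤ.≢-nonZero i≢0}} (≤-<-trans i≤ (⊔-pres-<m m<p n<p)))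
    where
    i≤ : ∣ i ∣ ≤ m ⊔ n
    i≤ = subst (λ i → ∣ i ∣ ≤ m ⊔ n) (trans (sym (ℤ.m-n≡m⊖n m n)) eq) (ℤ.∣m⊝n∣≤m⊔n m n)

  -- Lagrange's theorem: `Degree≤` itself supplies the quotient by x - r, and primality of p makes
  -- the other roots, incongruent to r, roots of that quotient. A function displays no coefficients,
  -- so triviality modulo p is expressed as vanishing at every integer.
  few-roots : ∀ n {f} → Degree≤ n f → ∀ xs → AllPairs _≉_ xs → All (λ x → f x ≈ 0ℤ) xs → n < length xs → ∀ x → f x ≈ 0ℤ
  few-roots zero    {f} df (r ∷ _) _ (fr≈0 ∷ _) _ x = begin
    f x    ≡⟨ trans (df x) (sym (df r)) ⟩
    f r    ≈⟨ fr≈0 ⟩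
    0ℤ     ∎
  few-roots (suc n) {f} df (r ∷ xs) (r≉xs ∷ xs≉) (fr≈0 ∷ fxs≈0) (s≤s n<xs) x with df r
  ... | g , dg , eq = ≈0 x (few-roots n dg xs xs≉ (All.zipWith g≈0 (r≉xs , fxs≈0)) n<xs x)
    where
    ≈0 : ∀ x → g x ≈ 0ℤ → f x ≈ 0ℤ
    ≈0 x gx≈0 = ∣⇒≈0 (subst (+ p ℤ∣.∣_) (sym (eq x)) (ℤ∣.∣m∣n⇒∣m+n (≈0⇒∣ fr≈0) (ℤ∣.∣n⇒∣m*n (x ℤ.- r) (≈0⇒∣ gx≈0))))
    g≈0 : ∀ {x} → r ≉ x × f x ≈ 0ℤ → g x ≈ 0ℤ
    g≈0 {x} (r≉x , fx≈0) with i*j≈0⇒i≈0∨j≈0 (x ℤ.- r) (g x)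
      (∣⇒≈0 (ℤ∣.∣m+n∣m⇒∣n (subst (+ p ℤ∣.∣_) (eq x) (≈0⇒∣ fx≈0)) (≈0⇒∣ fr≈0)))
    ... | inj₁ x≈r  = contradiction (≈-sym (congruent (≈0⇒∣ x≈r))) r≉x
    ... | inj₂ gx≈0 = gx≈0

  -- Lagrange's theorem for f - g, which is certified nontrivial modulo p by its constant term, the
  -- value at 0.
  agreements≤degree : ∀ m {f g} → Degree≤ m f → Degree≤ m g → f 0ℤ ≉ g 0ℤ → ∀ {xs} → Unique xs →
                      (∀ {x} → x ∈ xs → x < p × f (+ x) ≈ g (+ x)) → length xs ≤ m
  agreements≤degree m {f} {g} df dg f0≉g0 {xs} u h = ≮⇒≥ λ m<xs → f0≉g0 (≈0⇒≈ (few-roots m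
    (degree-+ m df (degree-scale m -1ℤ dg)) (map +_ xs) (incongruent u (proj₁ ∘ h))
    (All.map⁺ (All.tabulate (≈⇒≈0 ∘ proj₂ ∘ h))) (subst (m <_) (sym (length-map +_ xs)) m<xs) 0ℤ))
    where
    difference : ∀ i j → i ℤ.- j ≡ i ℤ.+ -1ℤ ℤ.* j
    difference = ℤ.solve-∀
    ≈⇒≈0 : ∀ {i j} → i ≈ j → i ℤ.+ -1ℤ ℤ.* j ≈ 0ℤ
    ≈⇒≈0 {i} {j} i≈j = ∣⇒≈0 (subst (+ p ℤ∣.∣_) (difference i j) (∣-difference i≈j))
    ≈0⇒≈ : ∀ {i j} → i ℤ.+ -1ℤ ℤ.* j ≈ 0ℤ → i ≈ j
    ≈0⇒≈ {i} {j} h = congruent (subst (+ p ℤ∣.∣_) (sym (difference i j)) (≈0⇒∣ h))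
    incongruent : ∀ {xs} → Unique xs → (∀ {x} → x ∈ xs → x < p) → AllPairs _≉_ (map +_ xs)
    incongruent []       _  = []
    incongruent (x∉ ∷ u) <p =
      All.map⁺ (All.tabulate λ y∈ x≈y → All.lookup x∉ y∈ (pos-≈⇒≡ (<p (here refl)) (<p (there y∈)) x≈y))
      ∷ incongruent u (<p ∘ there)

  -- The equation c₁ xᵐ⁺ᵏ ≡ c₂ xᵐ becomes c₁ xᵏ ≡ c₂ for x ≢ 0.
  binomial-roots≤degree : ∀ D m k .{{_ : NonZero k}} {c₁ c₂} → k ≤ D → c₂ ≉ 0ℤ → ∀ {xs} → Unique xs →
    (∀ {x} → x ∈ xs → 1 ≤ x × x < p × c₁ ℤ.* (+ x) ℤ.^ (m + k) ≈ c₂ ℤ.* (+ x) ℤ.^ m) → length xs ≤ D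
  binomial-roots≤degree D m k {c₁} {c₂} k≤D c₂≉0 u h =
    agreements≤degree D {λ x → c₁ ℤ.* x ℤ.^ k} {λ _ → c₂} (degree-scale D c₁ (degree-mono k≤D (degree-^ k))) (degree-const D c₂)
      (λ 0≈c₂ → c₂≉0 (≈-trans (≈-sym 0≈c₂) (≈-reflexive (trans (cong (c₁ ℤ.*_) (0ℤ^n≡0ℤ k)) (ℤ.*-zeroʳ c₁)))))
      u (λ {x} x∈ → let 1≤x , x<p , eq = h x∈ in x<p , ≈-*-cancelˡ (^-≉0 m (pos≉0 1≤x x<p)) (begin
        (+ x) ℤ.^ m ℤ.* (c₁ ℤ.* (+ x) ℤ.^ k)  ≡⟨ lemma ((+ x) ℤ.^ m) c₁ ((+ x) ℤ.^ k) ⟩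
        c₁ ℤ.* ((+ x) ℤ.^ m ℤ.* (+ x) ℤ.^ k)  ≡⟨ cong (c₁ ℤ.*_) (ℤ.^-distribˡ-+-* (+ x) m k) ⟨
        c₁ ℤ.* (+ x) ℤ.^ (m + k)              ≈⟨ eq ⟩
        c₂ ℤ.* (+ x) ℤ.^ m                    ≡⟨ ℤ.*-comm c₂ _ ⟩
        (+ x) ℤ.^ m ℤ.* c₂                    ∎))
    where
    lemma : ∀ u v w → u ℤ.* (v ℤ.* w) ≡ v ℤ.* (u ℤ.* w)
    lemma = ℤ.solve-∀

  +%≈ : ∀ m → + (m % p) ≈ + m
  +%≈ m = ≈-sym (subst (λ n → + n ≈ + (m % p)) (sym (m≡m%n+[m/n]*n m p))
    (congruent (ℤ∣.divides (+ (m / p)) (trans (cong (ℤ._- + (m % p)) (trans (ℤ.pos-+ (m % p) (m / p * p)) (cong (λ i → + (m % p) ℤ.+ i) (ℤ.pos-* (m / p) p))))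
       (lemma (+ (m % p)) (+ (m / p) ℤ.* + p))))))
    where
    lemma : ∀ a b → (a ℤ.+ b) ℤ.- a ≡ b
    lemma = ℤ.solve-∀

  -- Fermat's little theorem

  module _ {a : ℕ} (1≤a : 1 ≤ a) (a<p : a < p) where
    private
      units = range (p ∸ 1)
      p≡ : suc (p ∸ 1) ≡ p
      p≡ = m+[n∸m]≡n {1} {p} (>-nonZero⁻¹ p)
      unit< : ∀ {i} → i ∈ units → i < p
      unit< i∈ = ≤-<-trans (proj₂ (∈-range⁻ i∈)) (≤-reflexive p≡)
      unit≉0 : ∀ {i} → i ∈ units → + i ≉ 0ℤ
      unit≉0 i∈ = pos≉0 (proj₁ (∈-range⁻ i∈)) (unit< i∈)
      a≉0 = pos≉0 1≤a a<p
      a*_%p = λ i → (a * i) % p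
      a*i%p≈ : ∀ i → + (a* i %p) ≈ + a ℤ.* + i
      a*i%p≈ i = ≈-trans (+%≈ (a * i)) (≈-reflexive (ℤ.pos-* a i))

      a*-injective : ∀ {i j} → i ∈ units → j ∈ units → a* i %p ≡ a* j %p → i ≡ j
      a*-injective {i} {j} i∈ j∈ eq = pos-≈⇒≡ (unit< i∈) (unit< j∈) (≈-*-cancelˡ a≉0 (begin
        + a ℤ.* + i   ≈⟨ a*i%p≈ i ⟨
        + (a* i %p)   ≡⟨ cong +_ eq ⟩
        + (a* j %p)   ≈⟨ a*i%p≈ j ⟩
        + a ℤ.* + j   ∎))

      a*-unit : ∀ {i} → i ∈ units → a* i %p ∈ units
      a*-unit {i} i∈ with a* i %p in eq
      ... | zero  = contradiction (≈-trans (≈-sym (a*i%p≈ i)) (≈-reflexive (cong +_ eq))) (*-≉0 a≉0 (unit≉0 i∈))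
      ... | suc m = ∈-range⁺ (s≤s z≤n) (≤-pred (subst₂ _<_ eq (sym p≡) (m%n<n (a * i) p)))

      product-a* : ∀ is → + product (map a*_%p is) ≈ (+ a) ℤ.^ length is ℤ.* + product is
      product-a* []       = ≈-refl
      product-a* (i ∷ is) = begin
        + (a* i %p * product (map a*_%p is))     ≡⟨ ℤ.pos-* (a* i %p) _ ⟩
        + (a* i %p) ℤ.* + product (map a*_%p is) ≈⟨ ≈-*-cong (a*i%p≈ i) (product-a* is) ⟩
        (+ a ℤ.* + i) ℤ.* ((+ a) ℤ.^ length is ℤ.* + product is)  ≡⟨ lemma (+ a) (+ i) ((+ a) ℤ.^ length is) (+ product is) ⟩
        (+ a ℤ.* (+ a) ℤ.^ length is) ℤ.* (+ i ℤ.* + product is)  ≡⟨ cong (+ a ℤ.* (+ a) ℤ.^ length is ℤ.*_) (ℤ.pos-* i (product is)) ⟨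
        (+ a ℤ.* (+ a) ℤ.^ length is) ℤ.* + (i * product is)      ∎
        where
        lemma : ∀ a i u v → (a ℤ.* i) ℤ.* (u ℤ.* v) ≡ (a ℤ.* u) ℤ.* (i ℤ.* v)
        lemma = ℤ.solve-∀

      product≉0 : ∀ is → (∀ {i} → i ∈ is → i ∈ units) → + product is ≉ 0ℤ
      product≉0 []       h = 1≉0
      product≉0 (i ∷ is) h = subst (_≉ 0ℤ) (sym (ℤ.pos-* i (product is))) (*-≉0 (unit≉0 (h (here refl))) (product≉0 is (h ∘ there)))

    -- Multiplication by a permutes the residues 1 , ... , p - 1, so their product is unchanged
    -- modulo p when multiplied by a^(p - 1); being nonzero modulo p, it cancels.
    fermat : (+ a) ℤ.^ (p ∸ 1) ≈ 1ℤ
    fermat = ≈-*-cancelˡ (product≉0 units id) (begin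
      + product units ℤ.* (+ a) ℤ.^ (p ∸ 1)          ≡⟨ ℤ.*-comm (+ product units) _ ⟩
      (+ a) ℤ.^ (p ∸ 1) ℤ.* + product units          ≡⟨ cong (λ n → (+ a) ℤ.^ n ℤ.* + product units) (length-range (p ∸ 1)) ⟨
      (+ a) ℤ.^ length units ℤ.* + product units     ≈⟨ product-a* units ⟨
      + product (map a*_%p units)                    ≡⟨ cong +_ (product-↭ perm) ⟨
      + product units                                ≡⟨ ℤ.*-identityʳ _ ⟨
      + product units ℤ.* 1ℤ                         ∎)
      where
      perm = unique-⊆⇒↭ (unique-map a*_%p a*-injective (range-unique (p ∸ 1)))
        (λ j∈ → let i , i∈ , j≡ = ∈-map⁻ a*_%p j∈ in subst (_∈ units) (sym j≡) (a*-unit i∈))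
        (≤-reflexive (sym (length-map a*_%p units)))

  -- Equality of powers and the gcd of the exponents

  ^-≈-multiple : ∀ {u v} k m → u ℤ.^ m ≈ v ℤ.^ m → u ℤ.^ (k * m) ≈ v ℤ.^ (k * m)
  ^-≈-multiple {u} {v} k m h = subst₂ _≈_ (power u) (power v) (≈-^-cong k h)
    where
    power : ∀ w → (w ℤ.^ m) ℤ.^ k ≡ w ℤ.^ (k * m)
    power w = trans (ℤ.^-*-assoc w m k) (cong (w ℤ.^_) (*-comm m k))

  -- Bézout over ℕ has the form d + e = f, so exponents are subtracted by cancelling u^e, with no
  -- inverses. Only u has to be nonzero, because v^e is first replaced by u^e.
  ^-≈-difference : ∀ {u v} d e {f} → u ≉ 0ℤ → d + e ≡ f → u ℤ.^ e ≈ v ℤ.^ e → u ℤ.^ f ≈ v ℤ.^ f → u ℤ.^ d ≈ v ℤ.^ d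
  ^-≈-difference {u} {v} d e u≉0 refl eqe eqf = ≈-*-cancelˡ (^-≉0 e u≉0) (begin
    u ℤ.^ e ℤ.* u ℤ.^ d   ≡⟨ ℤ.*-comm (u ℤ.^ e) _ ⟩
    u ℤ.^ d ℤ.* u ℤ.^ e   ≡⟨ ℤ.^-distribˡ-+-* u d e ⟨
    u ℤ.^ (d + e)         ≈⟨ eqf ⟩
    v ℤ.^ (d + e)         ≡⟨ ℤ.^-distribˡ-+-* v d e ⟩
    v ℤ.^ d ℤ.* v ℤ.^ e   ≈⟨ ≈-*-cong (≈-refl {v ℤ.^ d}) eqe ⟨
    v ℤ.^ d ℤ.* u ℤ.^ e   ≡⟨ ℤ.*-comm (v ℤ.^ d) _ ⟩
    u ℤ.^ e ℤ.* v ℤ.^ d   ∎)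

  ^-≈-gcd : ∀ m n {u v} → u ≉ 0ℤ → u ℤ.^ m ≈ v ℤ.^ m → u ℤ.^ n ≈ v ℤ.^ n → u ℤ.^ gcd m n ≈ v ℤ.^ gcd m n
  ^-≈-gcd m n u≉0 eqm eqn with Bézout.identity (gcd-GCD m n)
  ... | Bézout.+- x y eq = ^-≈-difference (gcd m n) (y * n) u≉0 eq (^-≈-multiple y n eqn) (^-≈-multiple x m eqm)
  ... | Bézout.-+ x y eq = ^-≈-difference (gcd m n) (x * m) u≉0 eq (^-≈-multiple x m eqm) (^-≈-multiple y n eqn)

-- Collisions of products

module PowerClass (p : ℕ) (p-prime : Prime p) (d : ℕ) .{{_ : NonZero d}} (A : List ℕ) (A-unique : Unique A)
  (A⊆ : ∀ {x} → x ∈ A → x ∈ range (p ∸ 1))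
  (A-gcd : ∀ {x} → x ∈ A → gcd x (p ∸ 1) ≡ d)
  (A-power : ∀ {x y} → x ∈ A → y ∈ A → Modulo._≈_ p p-prime ((+ x) ℤ.^ x) ((+ y) ℤ.^ y))
  (R : ℕ) (R<p : R < p)
  where

  open Modulo p p-prime

  private module ≈-Reasoning = Relation.Binary.Reasoning.Setoid ≈-setoid

  private
    n = p ∸ 1
    1<p : 1 < p
    1<p = nonTrivial⇒n>1 p {{prime⇒nonTrivial p-prime}}
    p≡ : suc n ≡ p
    p≡ = m+[n∸m]≡n {1} {p} (<⇒≤ 1<p)
    instance
      n≢0 : NonZero n
      n≢0 = >-nonZero (≤-pred (subst (1 <_) (sym p≡) 1<p))

  A-pos : ∀ {x} → x ∈ A → 1 ≤ x
  A-pos x∈ = proj₁ (∈-range⁻ (A⊆ x∈))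

  A≤n : ∀ {x} → x ∈ A → x ≤ n
  A≤n x∈ = proj₂ (∈-range⁻ (A⊆ x∈))

  A<p : ∀ {x} → x ∈ A → x < p
  A<p x∈ = ≤-<-trans (A≤n x∈) (≤-reflexive p≡)

  A≉0 : ∀ {x} → x ∈ A → + x ≉ 0ℤ
  A≉0 x∈ = pos≉0 (A-pos x∈) (A<p x∈)

  ^-%-≈ : ∀ {x} m → x ∈ A → (+ x) ℤ.^ m ≈ (+ x) ℤ.^ (m % n)
  ^-%-≈ {x} m x∈ = begin
    (+ x) ℤ.^ m                                           ≡⟨ cong ((+ x) ℤ.^_) (m≡m%n+[m/n]*n m n) ⟩
    (+ x) ℤ.^ (m % n + m / n * n)                         ≡⟨ ℤ.^-distribˡ-+-* (+ x) (m % n) (m / n * n) ⟩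
    (+ x) ℤ.^ (m % n) ℤ.* (+ x) ℤ.^ (m / n * n)           ≈⟨ ≈-*-cong (≈-refl {(+ x) ℤ.^ (m % n)}) x^kn≈1 ⟩
    (+ x) ℤ.^ (m % n) ℤ.* 1ℤ                              ≡⟨ ℤ.*-identityʳ _ ⟩
    (+ x) ℤ.^ (m % n)                                     ∎
    where
    open ≈-Reasoning
    x^kn≈1 : (+ x) ℤ.^ (m / n * n) ≈ 1ℤ
    x^kn≈1 = begin
      (+ x) ℤ.^ (m / n * n)      ≡⟨ cong ((+ x) ℤ.^_) (*-comm (m / n) n) ⟩
      (+ x) ℤ.^ (n * (m / n))    ≡⟨ ℤ.^-*-assoc (+ x) n (m / n) ⟨
      ((+ x) ℤ.^ n) ℤ.^ (m / n)  ≈⟨ ≈-^-cong (m / n) (fermat (A-pos x∈) (A<p x∈)) ⟩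
      1ℤ ℤ.^ (m / n)             ≡⟨ ℤ.^-zeroˡ (m / n) ⟩
      1ℤ                         ∎

  ^-*-comm : ∀ i k l → (i ℤ.^ k) ℤ.^ l ≡ (i ℤ.^ l) ℤ.^ k
  ^-*-comm i k l = trans (ℤ.^-*-assoc i k l) (trans (cong (i ℤ.^_) (*-comm k l)) (sym (ℤ.^-*-assoc i l k)))

  -- Raising xˣ ≡ yʸ to the power b and using by ≡ ax (mod n) gives (xᵇ)ˣ ≡ (yᵃ)ˣ,
  -- and x may be replaced by gcd (x , n) in the exponent since xⁿ ≡ yⁿ ≡ 1.
  collision⇒power : ∀ {a b x y} → x ∈ A → y ∈ A → (a * x) % n ≡ (b * y) % n →
                    (+ x) ℤ.^ (b * d) ≈ (+ y) ℤ.^ (a * d)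
  collision⇒power {a} {b} {x} {y} x∈ y∈ eq = subst₂ _≈_ (ℤ.^-*-assoc (+ x) b d) (ℤ.^-*-assoc (+ y) a d)
    (subst (λ e → u ℤ.^ e ≈ v ℤ.^ e) (A-gcd x∈) (^-≈-gcd x n (^-≉0 b (A≉0 x∈)) uˣ≈vˣ uⁿ≈vⁿ))
    where
    open ≈-Reasoning
    u = (+ x) ℤ.^ b
    v = (+ y) ℤ.^ a
    uˣ≈vˣ : u ℤ.^ x ≈ v ℤ.^ x
    uˣ≈vˣ = begin
      ((+ x) ℤ.^ b) ℤ.^ x      ≡⟨ ^-*-comm (+ x) b x ⟩
      ((+ x) ℤ.^ x) ℤ.^ b      ≈⟨ ≈-^-cong b (A-power x∈ y∈) ⟩
      ((+ y) ℤ.^ y) ℤ.^ b      ≡⟨ trans (ℤ.^-*-assoc (+ y) y b) (cong ((+ y) ℤ.^_) (*-comm y b)) ⟩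
      (+ y) ℤ.^ (b * y)        ≈⟨ ^-%-≈ (b * y) y∈ ⟩
      (+ y) ℤ.^ ((b * y) % n)  ≡⟨ cong ((+ y) ℤ.^_) eq ⟨
      (+ y) ℤ.^ ((a * x) % n)  ≈⟨ ^-%-≈ (a * x) y∈ ⟨
      (+ y) ℤ.^ (a * x)        ≡⟨ ℤ.^-*-assoc (+ y) a x ⟨
      ((+ y) ℤ.^ a) ℤ.^ x      ∎
    power-n : ∀ {z} → z ∈ A → ∀ c → ((+ z) ℤ.^ c) ℤ.^ n ≈ 1ℤ
    power-n {z} z∈ c = begin
      ((+ z) ℤ.^ c) ℤ.^ n      ≡⟨ ^-*-comm (+ z) c n ⟩
      ((+ z) ℤ.^ n) ℤ.^ c      ≈⟨ ≈-^-cong c (fermat (A-pos z∈) (A<p z∈)) ⟩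
      1ℤ ℤ.^ c                 ≡⟨ ℤ.^-zeroˡ c ⟩
      1ℤ                       ∎
    uⁿ≈vⁿ : u ℤ.^ n ≈ v ℤ.^ n
    uⁿ≈vⁿ = ≈-trans (power-n x∈ b) (≈-sym (power-n y∈ a))

  -- As n = p - 1 ≡ -1 (mod p), the term kn becomes -k. This is where a relation between exponents
  -- modulo n is read as a relation between bases modulo p.
  linear : ∀ {a b x y} k → + a ℤ.* + x ≡ + b ℤ.* + y ℤ.+ k ℤ.* + n → + b ℤ.* + y ≈ + a ℤ.* + x ℤ.+ k
  linear {a} {b} {x} {y} k eq = congruent (subst (+ p ℤ∣.∣_) (sym rewrite-difference) (ℤ∣.∣n⇒∣m*n (ℤ.- k) ℤ∣.∣-refl))
    where
    lemma : ∀ u k n → u ℤ.- (u ℤ.+ k ℤ.* n ℤ.+ k) ≡ ℤ.- k ℤ.* (1ℤ ℤ.+ n)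
    lemma = ℤ.solve-∀
    rewrite-difference : + b ℤ.* + y ℤ.- (+ a ℤ.* + x ℤ.+ k) ≡ ℤ.- k ℤ.* + p
    rewrite-difference = trans (cong (λ v → + b ℤ.* + y ℤ.- (v ℤ.+ k)) eq)
      (trans (lemma (+ b ℤ.* + y) k (+ n)) (cong (λ m → ℤ.- k ℤ.* + m) p≡))

  -- Eliminates y: multiplying `collision⇒power` by b^(ad) turns its right side into (by)^(ad), to
  -- which `linear` applies without dividing by b.
  power-equation : ∀ {a b x y} k → x ∈ A → y ∈ A → (a * x) % n ≡ (b * y) % n →
    + a ℤ.* + x ≡ + b ℤ.* + y ℤ.+ k ℤ.* + n →
    (+ b) ℤ.^ (a * d) ℤ.* (+ x) ℤ.^ (b * d) ≈ (+ a ℤ.* + x ℤ.+ k) ℤ.^ (a * d)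
  power-equation {a} {b} {x} {y} k x∈ y∈ eq% eq = begin
    (+ b) ℤ.^ (a * d) ℤ.* (+ x) ℤ.^ (b * d)  ≈⟨ ≈-*-cong (≈-refl {(+ b) ℤ.^ (a * d)}) (collision⇒power {a} {b} x∈ y∈ eq%) ⟩
    (+ b) ℤ.^ (a * d) ℤ.* (+ y) ℤ.^ (a * d)  ≡⟨ ^-distribʳ-*ℤ (+ b) (+ y) (a * d) ⟨
    (+ b ℤ.* + y) ℤ.^ (a * d)                ≈⟨ ≈-^-cong (a * d) (linear {a} {b} {x} {y} k eq) ⟩
    (+ a ℤ.* + x ℤ.+ k) ℤ.^ (a * d)          ∎
    where open ≈-Reasoning

  L : List (ℕ × ℕ)
  L = cartesianProduct (range R) A

  -- For x in `A` both x and n are multiples of d, hence so is the residue. Division by d thus loses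
  -- nothing and leaves only n / d possible keys.
  key : ℕ × ℕ → ℕ
  key (a , x) = (a * x) % n / d

  Collision : (ℕ × ℕ) × (ℕ × ℕ) → Set
  Collision ((a , x) , (b , y)) = (a * x) % n ≡ (b * y) % n

  -- A collision modulo n lifted to an exact equation over ℤ. The triple (a , b , k) fixes the
  -- polynomial of which x is a root, so collisions are counted triple by triple.
  Linked : ℕ × ℕ × ℤ → (ℕ × ℕ) × (ℕ × ℕ) → Set
  Linked (a , b , k) ((a′ , x) , (b′ , y)) =
    a′ ≡ a × b′ ≡ b × ∣ k ∣ ≤ R × + a ℤ.* + x ≡ + b ℤ.* + y ℤ.+ k ℤ.* + n

  linked? : ∀ abk st → Dec (Linked abk st)
  linked? (a , b , k) ((a′ , x) , (b′ , y)) =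
    a′ ≟ a ×-dec b′ ≟ b ×-dec ∣ k ∣ ≤? R ×-dec + a ℤ.* + x ℤ.≟ + b ℤ.* + y ℤ.+ k ℤ.* + n

  module _ {a b : ℕ} {k : ℤ} (a∈ : a ∈ range R) (b∈ : b ∈ range R) (Z : List ((ℕ × ℕ) × (ℕ × ℕ))) (Z-unique : Unique Z)
    (Z-linked : ∀ {st} → st ∈ Z → Linked (a , b , k) st)
    (Z⊆ : ∀ {st} → st ∈ Z → proj₁ st ∈ L × proj₂ st ∈ L × Collision st × proj₁ st ≢ proj₂ st)
    where
    private
      1≤a = proj₁ (∈-range⁻ a∈)
      1≤b = proj₁ (∈-range⁻ b∈)
      a≤R = proj₂ (∈-range⁻ a∈)
      b≤R = proj₂ (∈-range⁻ b∈)
      a≉0 = pos≉0 1≤a (≤-<-trans a≤R R<p)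
      b≉0 = pos≉0 1≤b (≤-<-trans b≤R R<p)

      abscissa : (ℕ × ℕ) × (ℕ × ℕ) → ℕ
      abscissa ((_ , x) , _) = x

      abscissa-injective : ∀ {s t} → s ∈ Z → t ∈ Z → abscissa s ≡ abscissa t → s ≡ t
      abscissa-injective {(_ , x) , (_ , y)} {(_ , _) , (_ , y′)} s∈ t∈ refl
        with Z-linked s∈ | Z-linked t∈
      ... | refl , refl , _ , eq | refl , refl , _ , eq′ = cong (λ y → (a , x) , (b , y)) (ℤ.+-injective
              (ℤ.*-cancelˡ-≡ (+ b) (+ y) (+ y′) {{>-nonZero 1≤b}} (ℤ-Group.∙-cancelʳ (k ℤ.* + n) _ _ (trans (sym eq) eq′))))

      abscissae = map abscissa Z
      abscissae-unique = unique-map abscissa abscissa-injective Z-unique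

      m*d+[n∸m]*d : ∀ {l m} → l ≤ m → l * d + (m ∸ l) * d ≡ m * d
      m*d+[n∸m]*d {l} {m} l≤m = trans (sym (*-distribʳ-+ d l (m ∸ l))) (cong (_* d) (m+[n∸m]≡n l≤m))

      [a*x+0]^m : ∀ m x → (+ a ℤ.* + x ℤ.+ 0ℤ) ℤ.^ m ≡ (+ a) ℤ.^ m ℤ.* (+ x) ℤ.^ m
      [a*x+0]^m m x = trans (cong (ℤ._^ m) (ℤ.+-identityʳ (+ a ℤ.* + x))) (^-distribʳ-*ℤ (+ a) (+ x) m)

      solutions : ∀ {x} → x ∈ abscissae → ∃[ y ] x ∈ A × y ∈ A × (a , x) ≢ (b , y) ×
        + a ℤ.* + x ≡ + b ℤ.* + y ℤ.+ k ℤ.* + n ×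
        (+ b) ℤ.^ (a * d) ℤ.* (+ x) ℤ.^ (b * d) ≈ (+ a ℤ.* + x ℤ.+ k) ℤ.^ (a * d)
      solutions x∈ with ∈-map⁻ abscissa x∈
      ... | ((_ , x) , (_ , y)) , st∈ , refl with Z-linked st∈ | Z⊆ st∈
      ... | refl , refl , _ , eq | s∈ , t∈ , coll , s≢t =
        let _ , x∈ = ∈-cartesianProduct⁻ (range R) A s∈ ; _ , y∈ = ∈-cartesianProduct⁻ (range R) A t∈
        in y , x∈ , y∈ , s≢t , eq , power-equation {a} {b} {x} {y} k x∈ y∈ coll eq

    -- With a, b and k fixed, x determines y through the integer equation, so it suffices to bound
    -- the number of x. These are roots of a polynomial of degree at most Rd; the cases differ in
    -- why it is nontrivial.
    fibre≤ : ∣ k ∣ ≤ R → length Z ≤ R * d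
    fibre≤ k≤R = subst (_≤ R * d) (length-map abscissa Z) (bound (k ℤ.≟ 0ℤ) (<-cmp a b))
      where
      open ≈-Reasoning
      bound : Dec (k ≡ 0ℤ) → Tri (a < b) (a ≡ b) (b < a) → length abscissae ≤ R * d
      -- At 0 the left side vanishes because bd > 0, while the right side is k^(ad), which is
      -- nonzero modulo p since 0 < |k| ≤ R < p.
      bound (no k≢0) _ = agreements≤degree (R * d) {λ x → (+ b) ℤ.^ (a * d) ℤ.* x ℤ.^ (b * d)} {λ x → (+ a ℤ.* x ℤ.+ k) ℤ.^ (a * d)}
        (degree-scale (R * d) ((+ b) ℤ.^ (a * d)) (degree-mono (*-monoˡ-≤ d b≤R) (degree-^ (b * d))))
        (degree-mono (*-monoˡ-≤ d a≤R) (degree-linear-^ (+ a) k (a * d)))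
        (λ 0≈kᵃᵈ → ^-≉0 (a * d) (small≉0 k {{ℤ.≢-nonZero k≢0}} (≤-<-trans k≤R R<p)) (begin
          k ℤ.^ (a * d)                                  ≡⟨ cong (ℤ._^ (a * d)) (a*0+k (+ a) k) ⟩
          (+ a ℤ.* 0ℤ ℤ.+ k) ℤ.^ (a * d)                 ≈⟨ 0≈kᵃᵈ ⟨
          (+ b) ℤ.^ (a * d) ℤ.* 0ℤ ℤ.^ (b * d)           ≡⟨ cong ((+ b) ℤ.^ (a * d) ℤ.*_) (0ℤ^n≡0ℤ (b * d) {{m*n≢0 b d {{>-nonZero 1≤b}}}}) ⟩
          (+ b) ℤ.^ (a * d) ℤ.* 0ℤ                       ≡⟨ ℤ.*-zeroʳ ((+ b) ℤ.^ (a * d)) ⟩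
          0ℤ                                             ∎))
        abscissae-unique (λ x∈ → let _ , x∈A , _ , _ , _ , eq = solutions x∈ in A<p x∈A , eq)
        where
        a*0+k : ∀ a k → k ≡ a ℤ.* 0ℤ ℤ.+ k
        a*0+k = ℤ.solve-∀
      -- Here the polynomial equation is vacuous, but ax = ay over ℤ forces x = y, contradicting
      -- that the two pairs differ.
      bound (yes refl) (tri≈ _ refl _) = ≮⇒≥ λ R*d< → no-solution (nonempty abscissae (≤-<-trans z≤n R*d<))
        where
        nonempty : ∀ (zs : List ℕ) → 0 < length zs → ∃[ z ] z ∈ zs
        nonempty (z ∷ _) _ = z , here refl
        no-solution : ¬ (∃[ x ] x ∈ abscissae)
        no-solution (x , x∈) = let y , _ , _ , x≢y , eq , _ = solutions x∈ in x≢y (cong (a ,_) (ℤ.+-injective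
          (ℤ.*-cancelˡ-≡ (+ a) (+ x) (+ y) {{>-nonZero 1≤a}} (trans eq (ℤ.+-identityʳ (+ a ℤ.* + y))))))
      -- With k = 0 both sides vanish at 0, so the test at 0 works only after the smaller power of x
      -- has been divided out. The case b < a is the same with the sides exchanged.
      bound (yes refl) (tri< a<b _ _) = binomial-roots≤degree (R * d) (a * d) ((b ∸ a) * d)
        {{m*n≢0 (b ∸ a) d {{>-nonZero (m<n⇒0<n∸m a<b)}}}} {c₁ = (+ b) ℤ.^ (a * d)} (*-monoˡ-≤ d (≤-trans (m∸n≤m b a) b≤R)) (^-≉0 (a * d) a≉0)
        abscissae-unique (λ {x} x∈ → let _ , x∈A , _ , _ , _ , eq = solutions x∈ in A-pos x∈A , A<p x∈A , (begin
          (+ b) ℤ.^ (a * d) ℤ.* (+ x) ℤ.^ (a * d + (b ∸ a) * d)  ≡⟨ cong (λ e → (+ b) ℤ.^ (a * d) ℤ.* (+ x) ℤ.^ e) (m*d+[n∸m]*d (<⇒≤ a<b)) ⟩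
          (+ b) ℤ.^ (a * d) ℤ.* (+ x) ℤ.^ (b * d)                ≈⟨ eq ⟩
          (+ a ℤ.* + x ℤ.+ 0ℤ) ℤ.^ (a * d)                       ≡⟨ [a*x+0]^m (a * d) x ⟩
          (+ a) ℤ.^ (a * d) ℤ.* (+ x) ℤ.^ (a * d)                ∎))
      bound (yes refl) (tri> _ _ b<a) = binomial-roots≤degree (R * d) (b * d) ((a ∸ b) * d)
        {{m*n≢0 (a ∸ b) d {{>-nonZero (m<n⇒0<n∸m b<a)}}}} {c₁ = (+ a) ℤ.^ (a * d)} (*-monoˡ-≤ d (≤-trans (m∸n≤m a b) a≤R)) (^-≉0 (a * d) b≉0)
        abscissae-unique (λ {x} x∈ → let _ , x∈A , _ , _ , _ , eq = solutions x∈ in A-pos x∈A , A<p x∈A , (begin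
          (+ a) ℤ.^ (a * d) ℤ.* (+ x) ℤ.^ (b * d + (a ∸ b) * d)  ≡⟨ cong (λ e → (+ a) ℤ.^ (a * d) ℤ.* (+ x) ℤ.^ e) (m*d+[n∸m]*d (<⇒≤ b<a)) ⟩
          (+ a) ℤ.^ (a * d) ℤ.* (+ x) ℤ.^ (a * d)                ≡⟨ [a*x+0]^m (a * d) x ⟨
          (+ a ℤ.* + x ℤ.+ 0ℤ) ℤ.^ (a * d)                       ≈⟨ eq ⟨
          (+ b) ℤ.^ (a * d) ℤ.* (+ x) ℤ.^ (b * d)                ∎))

  module _ (d∣n : d ∣ n) where

    _≟²_ = ≡-dec _≟_ _≟_

    collisions = filter (sameKey? key) (cartesianProduct L L)

    distinct? : (st : (ℕ × ℕ) × (ℕ × ℕ)) → Dec (proj₁ st ≢ proj₂ st)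
    distinct? (s , t) = ¬? (s ≟² t)

    proper = filter distinct? collisions

    L-unique : Unique L
    L-unique = Unique.cartesianProduct⁺ (range-unique R) A-unique

    collisions-unique : Unique collisions
    collisions-unique = Unique.filter⁺ (sameKey? key) (Unique.cartesianProduct⁺ L-unique L-unique)

    key-divisible : ∀ {s} → s ∈ L → d ∣ (proj₁ s * proj₂ s) % n
    key-divisible {a , x} s∈ = %-presˡ-∣ (∣n⇒∣m*n a (subst (_∣ x) (A-gcd x∈) (gcd[m,n]∣m x n))) d∣n
      where x∈ = proj₂ (∈-cartesianProduct⁻ (range R) A s∈)

    proper⇒ : ∀ {st} → st ∈ proper → proj₁ st ∈ L × proj₂ st ∈ L × Collision st × proj₁ st ≢ proj₂ st
    proper⇒ {s , t} st∈ =
      let st∈c , s≢t = ∈-filter⁻ distinct? {xs = collisions} st∈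
          st∈L , eq = ∈-filter⁻ (sameKey? key) {xs = cartesianProduct L L} st∈c
          s∈ , t∈ = ∈-cartesianProduct⁻ L L st∈L
      in s∈ , t∈ , /d-injective (key-divisible s∈) (key-divisible t∈) eq , s≢t
      where
      /d-injective : ∀ {i j} → d ∣ i → d ∣ j → i / d ≡ j / d → i ≡ j
      /d-injective d∣i d∣j eq = trans (sym (m/n*n≡m d∣i)) (trans (cong (_* d) eq) (m/n*n≡m d∣j))

    shifts : List ℤ
    shifts = map (λ i → + i ℤ.- + R) (upTo (suc (R + R)))

    links : List (ℕ × ℕ × ℤ)
    links = cartesianProduct (range R) (cartesianProduct (range R) shifts)

    length-links : length links ≡ R * (R * suc (R + R))
    length-links = trans (length-× (range R) _) (cong₂ _*_ (length-range R)
      (trans (length-× (range R) shifts) (cong₂ _*_ (length-range R) (trans (length-map _ (upTo (suc (R + R)))) (length-upTo (suc (R + R)))))))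

    -- Equal residues make k the difference of the quotients of ax and by by n. Both quotients lie
    -- between 0 and R because a , b ≤ R and x , y ≤ n, whence |k| ≤ R.
    linked : ∀ {st} → st ∈ proper → ∃[ abk ] abk ∈ links × Linked abk st
    linked {(a , x) , (b , y)} st∈ with proper⇒ st∈
    ... | s∈ , t∈ , coll , _ =
      let a∈ , x∈ = ∈-cartesianProduct⁻ (range R) A s∈ ; b∈ , y∈ = ∈-cartesianProduct⁻ (range R) A t∈
          q≤R = quotient≤R a∈ x∈ ; r≤R = quotient≤R b∈ y∈
      -- The entry k = q - r of `shifts` has index q + (R - r), at most 2R.
      in (a , b , k) , ∈-cartesianProduct⁺ a∈ (∈-cartesianProduct⁺ b∈ (subst (_∈ shifts) (shift≡k q r r≤R) (∈-map⁺ _ (∈-upTo⁺ (s≤s (+-mono-≤ q≤R (m∸n≤m R r))))))) ,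
         refl , refl , subst (λ k → ∣ k ∣ ≤ R) (sym (ℤ.m-n≡m⊖n q r)) (≤-trans (ℤ.∣m⊝n∣≤m⊔n q r) (⊔-lub q≤R r≤R)) , equation
      where
      q = a * x / n
      r = b * y / n
      k = + q ℤ.- + r
      quotient≤R : ∀ {c z} → c ∈ range R → z ∈ A → c * z / n ≤ R
      quotient≤R c∈ z∈ = ≤-trans (/-monoˡ-≤ n (*-mono-≤ (proj₂ (∈-range⁻ c∈)) (A≤n z∈))) (≤-reflexive (m*n/n≡m R n))
      shift≡k : ∀ q r → r ≤ R → + (q + (R ∸ r)) ℤ.- + R ≡ + q ℤ.- + r
      shift≡k q r r≤R = trans (cong₂ (λ i j → i ℤ.- + j) (ℤ.pos-+ q (R ∸ r)) (sym (m+[n∸m]≡n r≤R)))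
        (trans (cong (λ j → + q ℤ.+ + (R ∸ r) ℤ.- j) (ℤ.pos-+ r (R ∸ r))) (lemma (+ q) (+ (R ∸ r)) (+ r)))
        where
        lemma : ∀ q s r → q ℤ.+ s ℤ.- (r ℤ.+ s) ≡ q ℤ.- r
        lemma = ℤ.solve-∀
      divMod : ∀ m → + m ≡ + (m % n) ℤ.+ + (m / n) ℤ.* + n
      divMod m = trans (cong +_ (m≡m%n+[m/n]*n m n)) (trans (ℤ.pos-+ (m % n) _) (cong (λ i → + (m % n) ℤ.+ i) (ℤ.pos-* (m / n) n)))
      equation : + a ℤ.* + x ≡ + b ℤ.* + y ℤ.+ k ℤ.* + n
      equation = begin
        + a ℤ.* + x                                               ≡⟨ ℤ.pos-* a x ⟨
        + (a * x)                                                 ≡⟨ divMod (a * x) ⟩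
        + ((a * x) % n) ℤ.+ + q ℤ.* + n                           ≡⟨ cong (λ m → + m ℤ.+ + q ℤ.* + n) coll ⟩
        + ((b * y) % n) ℤ.+ + q ℤ.* + n                           ≡⟨ lemma (+ ((b * y) % n)) (+ q) (+ r) (+ n) ⟩
        + ((b * y) % n) ℤ.+ + r ℤ.* + n ℤ.+ k ℤ.* + n             ≡⟨ cong (ℤ._+ k ℤ.* + n) (divMod (b * y)) ⟨
        + (b * y) ℤ.+ k ℤ.* + n                                   ≡⟨ cong (ℤ._+ k ℤ.* + n) (ℤ.pos-* b y) ⟩
        + b ℤ.* + y ℤ.+ k ℤ.* + n                                 ∎
        where
        open ≡-Reasoning
        lemma : ∀ m q r n → m ℤ.+ q ℤ.* n ≡ m ℤ.+ r ℤ.* n ℤ.+ (q ℤ.- r) ℤ.* n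
        lemma = ℤ.solve-∀

    fibre-bound : ∀ {abk} → abk ∈ links → length (filter (linked? abk) proper) ≤ R * d
    fibre-bound {abk@(a , b , k)} abk∈ =
      let a∈ , bk∈ = ∈-cartesianProduct⁻ (range R) (cartesianProduct (range R) shifts) abk∈
          b∈ , _ = ∈-cartesianProduct⁻ (range R) shifts bk∈
      -- The bound on |k| is read off from a linked pair; arguing by contradiction provides one,
      -- since a length above Rd makes `Z` nonempty.
      in ≮⇒≥ λ Rd< → <⇒≱ Rd< (fibre≤ {a} {b} {k} a∈ b∈ Z (Unique.filter⁺ (linked? abk) (Unique.filter⁺ distinct? collisions-unique))
          (proj₂ ∘ ∈-filter⁻ (linked? abk) {xs = proper}) (proper⇒ ∘ proj₁ ∘ ∈-filter⁻ (linked? abk) {xs = proper})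
          (∣k∣≤R Z (λ st∈ → proj₁ (proj₂ (proj₂ (proj₂ (∈-filter⁻ (linked? abk) {xs = proper} st∈))))) (≤-<-trans z≤n Rd<)))
      where
      Z = filter (linked? abk) proper
      ∣k∣≤R : ∀ {B : Set} (Z : List B) → (∀ {st} → st ∈ Z → ∣ k ∣ ≤ R) → 0 < length Z → ∣ k ∣ ≤ R
      ∣k∣≤R (_ ∷ _) h _ = h (here refl)

    -- The diagonal escapes the root count, as its equation is vacuous, and is counted separately by
    -- the length of `L`. The other collisions are spread over R²(2R + 1) triples with at most Rd
    -- each.
    collisions≤ : length collisions ≤ R * length A + R * (R * suc (R + R)) * (R * d)
    collisions≤ = begin
      length collisions                                ≤⟨ unique-⊆⇒length≤ collisions-unique split ⟩
      length (map (λ s → s , s) L ++ proper)           ≡⟨ length-++ (map (λ s → s , s) L) ⟩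
      length (map (λ s → s , s) L) + length proper     ≡⟨ cong (_+ length proper) (trans (length-map _ L) (trans (length-× (range R) A) (cong (_* length A) (length-range R)))) ⟩
      R * length A + length proper                     ≤⟨ +-monoʳ-≤ (R * length A) (length≤∑-fibres linked? links proper linked) ⟩
      R * length A + ∑ links (λ abk → length (filter (linked? abk) proper)) ≤⟨ +-monoʳ-≤ (R * length A) (∑-mono links fibre-bound) ⟩
      R * length A + ∑ links (λ _ → R * d)             ≡⟨ cong (λ m → R * length A + m) (trans (∑-const links (R * d)) (cong (_* (R * d)) length-links)) ⟩
      R * length A + R * (R * suc (R + R)) * (R * d)   ∎
      where
      open ≤-Reasoning
      split : ∀ {st} → st ∈ collisions → st ∈ map (λ s → s , s) L ++ proper
      split {s , t} st∈ with s ≟² t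
      ... | yes refl = ∈-++⁺ˡ (∈-map⁺ (λ s → s , s) (proj₁ (∈-cartesianProduct⁻ L L (proj₁ (∈-filter⁻ (sameKey? key) {xs = cartesianProduct L L} st∈)))))
      ... | no s≢t   = ∈-++⁺ʳ (map (λ s → s , s) L) (∈-filter⁺ distinct? st∈ s≢t)

    class-energy : (R * length A) * (R * length A) ≤ n / d * (R * length A + R * (R * suc (R + R)) * (R * d))
    class-energy = begin
      (R * length A) * (R * length A)   ≡⟨ cong (λ m → m * m) length-L ⟨
      length L * length L               ≤⟨ length²≤keys*collisions key (upTo (n / d)) (Unique.upTo⁺ (n / d)) L L-unique key∈ ⟩
      length (upTo (n / d)) * length collisions  ≡⟨ cong (_* length collisions) (length-upTo (n / d)) ⟩
      n / d * length collisions         ≤⟨ *-monoʳ-≤ (n / d) collisions≤ ⟩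
      n / d * (R * length A + R * (R * suc (R + R)) * (R * d)) ∎
      where
      open ≤-Reasoning
      length-L : length L ≡ R * length A
      length-L = trans (length-× (range R) A) (cong (_* length A) (length-range R))
      key∈ : ∀ {s} → s ∈ L → key s ∈ upTo (n / d)
      key∈ {a , x} _ = ∈-upTo⁺ (m<n*o⇒m/o<n (<-≤-trans (m%n<n (a * x) n) (≤-reflexive (sym (m/n*n≡m d∣n)))))

-- Choice of R and summation over the classes

integer-root : ∀ k m .{{_ : NonZero k}} → ∃[ r ] r ^ k ≤ m × m < suc r ^ k
integer-root k@(suc _) zero = 0 , z≤n , ≤-reflexive (sym (^-zeroˡ k))
integer-root k (suc m) with r , r^k≤m , m<[1+r]^k ← integer-root k m | suc m <? suc r ^ k
... | yes 1+m< = r , m≤n⇒m≤1+n r^k≤m , 1+m<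
... | no  1+m≮ = suc r , ≮⇒≥ 1+m≮ , ≤-<-trans m<[1+r]^k (^-monoˡ-< k ≤-refl)

-- To be read with N = |A|, W = R|A|, M = n / d and X = Rd. If W ≤ 2M, then |A| ≤ 2p / R, and p ≤
-- 16R⁴ gives the constant 256 = 16 · 2⁴. Otherwise the term MW is at most W² / 2 and is absorbed,
-- leaving W² ≤ 6pR⁴; now R⁴ ≤ p gives the smaller constant 36.
energy⇒fourth-power-bound : ∀ {W M X R N p} → W ≡ R * N → W * W ≤ M * (W + R * (R * suc (R + R)) * X) → M ≤ p → M * X ≤ R * p →
  1 ≤ R → R ^ 4 ≤ p → p ≤ 16 * R ^ 4 → N ^ 4 ≤ 256 * p ^ 3
energy⇒fourth-power-bound {W} {M} {X} {R} {N} {p} refl energy M≤p MX≤Rp 1≤R R⁴≤p p≤16R⁴ with ≤-total W (2 * M)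
... | inj₁ W≤2M = *-cancelʳ-≤ (N ^ 4) (256 * p ^ 3) p {{>-nonZero (≤-trans (m^n>0 R 4) R⁴≤p)}} (begin
  N ^ 4 * p               ≤⟨ *-monoʳ-≤ (N ^ 4) p≤16R⁴ ⟩
  N ^ 4 * (16 * R ^ 4)    ≡⟨ collect N R ⟩
  16 * (R * N) ^ 4        ≤⟨ *-monoʳ-≤ 16 (^-monoˡ-≤ 4 (≤-trans W≤2M (*-monoʳ-≤ 2 M≤p))) ⟩
  16 * (2 * p) ^ 4        ≡⟨ expand p ⟩
  256 * p ^ 3 * p         ∎)
  where
  open ≤-Reasoning
  instance _ = >-nonZero 1≤R
  collect : ∀ N R → N ^ 4 * (16 * R ^ 4) ≡ 16 * (R * N) ^ 4
  collect = solve 2 (λ N R → N :^ 4 :* (con 16 :* R :^ 4) := con 16 :* (R :* N) :^ 4) refl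
  expand : ∀ p → 16 * (2 * p) ^ 4 ≡ 256 * p ^ 3 * p
  expand = solve 1 (λ p → con 16 :* (con 2 :* p) :^ 4 := con 256 :* p :^ 3 :* p) refl
... | inj₂ 2M≤W = *-cancelʳ-≤ (N ^ 4) (256 * p ^ 3) (R ^ 4) (begin
  N ^ 4 * R ^ 4                        ≡⟨ collect N R ⟩
  (W * W) * (W * W)                    ≤⟨ *-mono-≤ W²≤ W²≤ ⟩
  (6 * (p * R ^ 4)) * (6 * (p * R ^ 4)) ≡⟨ expand p (R ^ 4) ⟩
  36 * (p * p * R ^ 4) * R ^ 4         ≤⟨ *-monoˡ-≤ (R ^ 4) (*-mono-≤ (m≤m+n 36 220) (*-monoʳ-≤ (p * p) R⁴≤p)) ⟩
  256 * (p * p * p) * R ^ 4            ≡⟨ cong (λ c → 256 * c * R ^ 4) (cube p) ⟩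
  256 * p ^ 3 * R ^ 4                  ∎)
  where
  open ≤-Reasoning
  instance
    _ = >-nonZero 1≤R
    _ = m^n≢0 R 4
  collect : ∀ N R → N ^ 4 * R ^ 4 ≡ (R * N * (R * N)) * (R * N * (R * N))
  collect = solve 2 (λ N R → N :^ 4 :* R :^ 4 := (R :* N :* (R :* N)) :* (R :* N :* (R :* N))) refl
  expand : ∀ p r → (6 * (p * r)) * (6 * (p * r)) ≡ 36 * (p * p * r) * r
  expand = solve-∀
  cube : ∀ p → p * p * p ≡ p ^ 3
  cube = solve 1 (λ p → p :* p :* p := p :^ 3) refl
  off-diagonal≤ : M * (R * (R * suc (R + R)) * X) ≤ 3 * (p * R ^ 4)
  off-diagonal≤ = begin
    M * (R * (R * suc (R + R)) * X)      ≡⟨ regroup M R X ⟩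
    (M * X) * (R * R * suc (R + R))      ≤⟨ *-mono-≤ MX≤Rp (*-monoʳ-≤ (R * R) (+-monoˡ-≤ (R + R) 1≤R)) ⟩
    (R * p) * (R * R * (R + (R + R)))    ≡⟨ total R p ⟩
    3 * (p * R ^ 4)                      ∎
    where
    regroup : ∀ M R X → M * (R * (R * suc (R + R)) * X) ≡ (M * X) * (R * R * suc (R + R))
    regroup = solve-∀
    total : ∀ R p → (R * p) * (R * R * (R + (R + R))) ≡ 3 * (p * R ^ 4)
    total = solve 2 (λ R p → (R :* p) :* (R :* R :* (R :+ (R :+ R))) := con 3 :* (p :* R :^ 4)) refl
  W²≤ : W * W ≤ 6 * (p * R ^ 4)
  -- The energy inequality is doubled so that 2MW ≤ W² can be absorbed without halving.
  W²≤ = +-cancelˡ-≤ (W * W) (W * W) (6 * (p * R ^ 4)) (begin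
    W * W + W * W                                            ≤⟨ +-mono-≤ energy energy ⟩
    M * (W + _) + M * (W + _)                                ≡⟨ regroup M W _ ⟩
    2 * M * W + 2 * (M * (R * (R * suc (R + R)) * X))        ≤⟨ +-mono-≤ (*-monoˡ-≤ W 2M≤W) (*-monoʳ-≤ 2 off-diagonal≤) ⟩
    W * W + 2 * (3 * (p * R ^ 4))                            ≡⟨ cong (λ c → W * W + c) (*-assoc 2 3 (p * R ^ 4)) ⟨
    W * W + 6 * (p * R ^ 4)                                  ∎)
    where
    regroup : ∀ M W Y → M * (W + Y) + M * (W + Y) ≡ 2 * M * W + 2 * (M * Y)
    regroup = solve-∀

class-size : ℕ → ℕ → ℕ → ℕ
class-size p x d = length (filter (λ y → gcd y (p ∸ 1) ≟ d) (filter (λ y → solution? p (x , y)) (range (p ∸ 1))))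

module _ {p : ℕ} (p-prime : Prime p) where
  open Modulo p p-prime

  private
    n = p ∸ 1
    1<p : 1 < p
    1<p = nonTrivial⇒n>1 p {{prime⇒nonTrivial p-prime}}
    n≤p : n ≤ p
    n≤p = m∸n≤m p 1
    instance
      p≢0 = prime⇒nonZero p-prime
      n≢0 : NonZero n
      n≢0 = >-nonZero (m<n⇒0<n∸m 1<p)

  [mod]⇒≈ : ∀ {x y} → x ^ x ≡ y ^ y [mod p ] → (+ x) ℤ.^ x ≈ (+ y) ℤ.^ y
  [mod]⇒≈ {x} {y} h = subst₂ _≈_ (pos-^ x x) (pos-^ y y) (congruent (ℤ∣.∣ᵤ⇒∣ (subst (p ∣_) (sym (∣+m-+n∣ (x ^ x) (y ^ y))) h)))

  class-size≤ : ∀ x {d} → d ∣ n → class-size p x d ^ 4 ≤ 256 * p ^ 3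
  class-size≤ x {d} d∣n with R , R⁴≤p , p<[1+R]⁴ ← integer-root 4 p =
    energy⇒fourth-power-bound {M = n / d} {X = R * d} refl (class-energy d∣n) M≤p MX≤Rp (1≤R R p<[1+R]⁴) R⁴≤p
      (≤-trans (<⇒≤ p<[1+R]⁴) ([1+R]⁴≤ (1≤R R p<[1+R]⁴)))
    where
    instance
      d≢0 : NonZero d
      d≢0 = ≢-nonZero λ { refl → ≢-nonZero⁻¹ n (0∣⇒≡0 d∣n) }
    S = filter (λ y → solution? p (x , y)) (range n)
    class = filter (λ y → gcd y n ≟ d) S
    class⇒ : ∀ {y} → y ∈ class → y ∈ range n × Solution p (x , y) × gcd y n ≡ d
    class⇒ y∈ =
      let y∈S , g = ∈-filter⁻ (λ y → gcd y n ≟ d) {xs = S} y∈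
          y∈r , s = ∈-filter⁻ (λ y → solution? p (x , y)) {xs = range n} y∈S
      in y∈r , s , g
    1≤R : ∀ R → p < suc R ^ 4 → 1 ≤ R
    1≤R zero    p<1 = contradiction 1<p (<-asym p<1)
    1≤R (suc R) _   = s≤s z≤n
    [1+R]⁴≤ : ∀ {R} → 1 ≤ R → suc R ^ 4 ≤ 16 * R ^ 4
    [1+R]⁴≤ {R} 1≤R = ≤-trans (^-monoˡ-≤ 4 (+-monoˡ-≤ R 1≤R)) (≤-reflexive (lemma R))
      where
      lemma : ∀ R → (R + R) ^ 4 ≡ 16 * R ^ 4
      lemma = solve 1 (λ R → (R :+ R) :^ 4 := con 16 :* R :^ 4) refl
    R<p : R < p
    -- If p ≤ R, then p⁴ ≤ R⁴ ≤ p, impossible for p > 1.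
    R<p = ≰⇒> λ p≤R → <⇒≱ (subst (_< p ^ 4) (^-identityʳ p) (^-monoʳ-< p 1<p (s≤s (s≤s (z≤n {2}))))) (≤-trans (^-monoˡ-≤ 4 p≤R) R⁴≤p)
    class-unique : Unique class
    class-unique = Unique.filter⁺ _ (Unique.filter⁺ _ (range-unique n))
    class-power : ∀ {y z} → y ∈ class → z ∈ class → (+ y) ℤ.^ y ≈ (+ z) ℤ.^ z
    class-power {y} {z} y∈ z∈ = ≈-trans (≈-sym ([mod]⇒≈ {x} {y} (proj₁ (proj₂ (class⇒ y∈))))) ([mod]⇒≈ {x} {z} (proj₁ (proj₂ (class⇒ z∈))))
    open PowerClass p p-prime d class class-unique (proj₁ ∘ class⇒) (proj₂ ∘ proj₂ ∘ class⇒) class-power R R<p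
    M≤p : n / d ≤ p
    M≤p = ≤-trans (m/n≤m n d) n≤p
    -- The factor d lost in the degree cancels the one gained in the number of keys, so the bound is
    -- uniform in d.
    MX≤Rp : n / d * (R * d) ≤ R * p
    MX≤Rp = begin
      n / d * (R * d)     ≡⟨ x∙yz≈y∙xz (n / d) R d ⟩
      R * (n / d * d)     ≤⟨ *-monoʳ-≤ R (≤-trans (m/n*n≤m n d) n≤p) ⟩
      R * p               ∎
      where
      open ≤-Reasoning

  module _ {C K : ℕ} (τ-bound : τ n ^ 6 ≤ C * n)
    (class-bound : ∀ x {d} → d ∣ n → class-size p x d ^ 4 ≤ K * p ^ 3)
    where

    private constant = C ^ 2 * K ^ 3

    -- Twelve is the least common multiple of 6 and 4, the powers in which the bounds on τ and on a
    -- class are given; together they contribute p² · p⁹ = p¹¹. The gcd with n assigns every y to a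
    -- class.
    row≤ : ∀ x → length (filter (λ y → solution? p (x , y)) (range n)) ^ 12 ≤ constant * p ^ 11
    row≤ x with m , m⁴≤ , S≤ ← ∑-bounded (λ m → m ^ 4 ≤ K * p ^ 3) z≤n (divisors n) {f = class-size p x}
                                 (λ d∈ → class-bound x (∈-divisors⁻ n d∈)) = begin
      length S ^ 12                                ≤⟨ ^-monoˡ-≤ 12 (≤-trans (length≤∑-fibres (λ d y → gcd y n ≟ d) (divisors n) S
                                                       (λ {y} _ → gcd y n , ∈-divisors⁺ (gcd[m,n]∣n y n) , refl)) S≤) ⟩
      (τ n * m) ^ 12                               ≡⟨ split (τ n) m ⟩
      (τ n ^ 6) ^ 2 * (m ^ 4) ^ 3                  ≤⟨ *-mono-≤ (^-monoˡ-≤ 2 (≤-trans τ-bound (*-monoʳ-≤ C n≤p))) (^-monoˡ-≤ 3 m⁴≤) ⟩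
      (C * p) ^ 2 * (K * p ^ 3) ^ 3                ≡⟨ collect C K p ⟩
      C ^ 2 * K ^ 3 * p ^ 11                       ∎
      where
      open ≤-Reasoning
      S = filter (λ y → solution? p (x , y)) (range n)
      split : ∀ t m → (t * m) ^ 12 ≡ (t ^ 6) ^ 2 * (m ^ 4) ^ 3
      split = solve 2 (λ t m → (t :* m) :^ 12 := (t :^ 6) :^ 2 :* (m :^ 4) :^ 3) refl
      collect : ∀ C K p → (C * p) ^ 2 * (K * p ^ 3) ^ 3 ≡ C ^ 2 * K ^ 3 * p ^ 11
      collect = solve 3 (λ C K p → (C :* p) :^ 2 :* (K :* p :^ 3) :^ 3 := C :^ 2 :* K :^ 3 :* p :^ 11) refl

    I^12≤ : I p ^ 12 ≤ constant * p ^ 23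
    I^12≤ with m , m¹²≤ , I≤ ← ∑-bounded (λ m → m ^ 12 ≤ constant * p ^ 11) z≤n (range n) (λ {x} _ → row≤ x) = begin
      I p ^ 12                                     ≡⟨ cong (_^ 12) (length-filter-× (solution? p) (range n) (range n)) ⟩
      _                                            ≤⟨ ^-monoˡ-≤ 12 (≤-trans I≤ (*-monoˡ-≤ m (≤-trans (≤-reflexive (length-range n)) n≤p))) ⟩
      (p * m) ^ 12                                 ≡⟨ ^-distribʳ-* p m 12 ⟩
      p ^ 12 * m ^ 12                              ≤⟨ *-monoʳ-≤ (p ^ 12) m¹²≤ ⟩
      p ^ 12 * (constant * p ^ 11)                 ≡⟨ x∙yz≈y∙xz (p ^ 12) constant (p ^ 11) ⟩
      constant * (p ^ 12 * p ^ 11)                 ≡⟨ cong (constant *_) (^-distribˡ-+-* p 12 11) ⟨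
      constant * p ^ 23                            ∎
      where
      open ≤-Reasoning

from-class-bound : ∀ {C K} → (∀ n .{{_ : NonZero n}} → τ n ^ 6 ≤ C * n) →
  (∀ {p} → Prime p → ∀ x {d} → d ∣ p ∸ 1 → class-size p x d ^ 4 ≤ K * p ^ 3) →
  ∀ p → Prime p → I p ^ 12 ≤ C ^ 2 * K ^ 3 * p ^ 23
from-class-bound {C} {K} τ-bound class-bound p p-prime = I^12≤ p-prime {C} {K}
    (τ-bound (p ∸ 1) {{>-nonZero (m<n⇒0<n∸m (nonTrivial⇒n>1 p {{prime⇒nonTrivial p-prime}}))}}) (class-bound p-prime)

-- The constant is a concrete but astronomically large number, which must not be unfolded.
abstract
  I-bounded : ∃[ D ] (∀ p → Prime p → I p ^ 12 ≤ D * p ^ 23)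
  I-bounded = let C , τ-bound = τ-bounded 6 in
    C ^ 2 * 256 ^ 3 , from-class-bound {C} {256} τ-bound class-size≤

-- From integer powers to rational exponents

fromℕ-* : ∀ m n → fromℕ m ℚ.* fromℕ n ≡ fromℕ (m * n)
fromℕ-* m n = cong (λ i → mkℚᵘ i 0) (sym (ℤ.pos-* m n))

fromℕ-^ : ∀ m n → fromℕ m ^ℚ n ≡ fromℕ (m ^ n)
fromℕ-^ m zero    = refl
fromℕ-^ m (suc n) = trans (cong (fromℕ m ℚ.*_) (fromℕ-^ m n)) (fromℕ-* m (m ^ n))

fromℕ-mono-< : ∀ {m n} → m < n → fromℕ m ℚ.< fromℕ n
fromℕ-mono-< {m} {n} m<n = ℚ.*<* (subst₂ ℤ._<_ (sym (ℤ.*-identityʳ (+ m))) (sym (ℤ.*-identityʳ (+ n))) (ℤ.+<+ m<n))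

<·^-intro : ∀ {a c p r} m → ↥ r ≡ + m → fromℕ a ^ℚ ↧ₙ r ℚ.< c ^ℚ ↧ₙ r ℚ.* fromℕ p ^ℚ m → a < c · p ^ r
<·^-intro {r = mkℚᵘ (+ m) _} .m refl a< = a<

-- The unnormalised sum of m / k and u / v has denominator kv and numerator mv + uk, so the bound on
-- a^k is raised to the power v, with e = uk the share of ε. Strictness comes from D < E^k.
raise-< : ∀ {a D E p} k m v e .{{_ : NonZero p}} .{{_ : NonZero E}} .{{_ : NonZero v}} →
          D < E ^ k → a ^ k ≤ D * p ^ m → a ^ (k * v) < E ^ (k * v) * p ^ (m * v + e)
raise-< {a} {D} {E} {p} k m v e D< aᵏ≤ = begin-strict
  a ^ (k * v)                      ≡⟨ ^-*-assoc a k v ⟨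
  (a ^ k) ^ v                      <⟨ ^-monoˡ-< v (≤-<-trans aᵏ≤ (*-monoˡ-< (p ^ m) {{m^n≢0 p m}} D<)) ⟩
  (E ^ k * p ^ m) ^ v              ≡⟨ ^-distribʳ-* (E ^ k) (p ^ m) v ⟩
  (E ^ k) ^ v * (p ^ m) ^ v        ≡⟨ cong₂ _*_ (^-*-assoc E k v) (^-*-assoc p m v) ⟩
  E ^ (k * v) * p ^ (m * v)        ≤⟨ *-monoʳ-≤ (E ^ (k * v)) (^-monoʳ-≤ p (m≤m+n (m * v) e)) ⟩
  E ^ (k * v) * p ^ (m * v + e)    ∎
  where open ≤-Reasoning

fromℕ-power-< : ∀ {a E p} k m → a ^ k < E ^ k * p ^ m → fromℕ a ^ℚ k ℚ.< fromℕ E ^ℚ k ℚ.* fromℕ p ^ℚ m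
fromℕ-power-< {a} {E} {p} k m a< = subst₂ ℚ._<_ (sym (fromℕ-^ a k))
  (trans (sym (fromℕ-* (E ^ k) (p ^ m))) (sym (cong₂ ℚ._*_ (fromℕ-^ E k) (fromℕ-^ p m))))
  (fromℕ-mono-< a<)

n<[1+n]^k : ∀ n k .{{_ : NonZero k}} → n < suc n ^ k
n<[1+n]^k n (suc k) = m≤m*n (suc n) (suc n ^ k) {{m^n≢0 (suc n) k}}

exponent-bound : ∀ {D} → (∀ p → Prime p → I p ^ 12 ≤ D * p ^ 23) → ∀ u v-1 p → Prime p →
  I p < fromℕ (suc D) · p ^ (+ 23 ℚ./ 12 ℚ.+ mkℚᵘ (+ suc u) v-1)
exponent-bound {D} I-bound u v-1 p p-prime =
  <·^-intro {I p} {fromℕ (suc D)} {p} {+ 23 ℚ./ 12 ℚ.+ mkℚᵘ (+ suc u) v-1} (23 * v + suc u * 12) refl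
    (fromℕ-power-< {I p} {suc D} {p} (12 * v) (23 * v + suc u * 12)
      (raise-< {I p} {D} {suc D} {p} 12 23 v (suc u * 12) {{prime⇒nonZero p-prime}} (n<[1+n]^k D 12) (I-bound p p-prime)))
  where v = suc v-1

theorem3 : ∀ (ε : ℚᵘ) → 0ℚᵘ ℚ.< ε →
    ∃[ c ] 0ℚᵘ ℚ.< c × (∀ (p : ℕ) → Prime p → I p < c · p ^ (+ 23 ℚ./ 12 ℚ.+ ε))
theorem3 (mkℚᵘ (+ zero)  _)   (ℚ.*<* (ℤ.+<+ ()))
theorem3 (mkℚᵘ (+ suc u) v-1) _ =
  -- The constant enters the inequality through its powers, and c = D + 1 has a twelfth power
  -- exceeding D.
  let D , I-bound = I-bounded in fromℕ (suc D) , fromℕ-mono-< (s≤s z≤n) , exponent-bound I-bound u v-1
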